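{- For every integer $k\geq 4$ with $k\equiv 1 \pmod 3$ there exist a constant $c_k>0$ (depending only on $k$) and a sequence $(f_n)_{n\geq k}$, where each $f_n:\{0,1\}^{\binom{n}{k}}\rightarrow\{0,1\}$ is a non-constant $k$-uniform hypergraph property on $n$ vertices, such that $s(f_n)\leq c_k\, n^{\lceil k/3\rceil-1/2}$ for all $n\geq k$; that is, $s(f_n)=O(n^{\lceil k/3\rceil-1/2})$.
   Context: For a Boolean function $f:\{0,1\}^N\rightarrow\{0,1\}$ and an input $x\in\{0,1\}^N$, let $x^{\{i\}}$ denote $x$ with its $i$-th bit flipped. The sensitivity of $f$ on $x$ is $s(f,x)=|\{i : f(x)\neq f(x^{\{i\}})\}|$, and the sensitivity of $f$ is $s(f)=\max_x s(f,x)$. Index the variables of $f:\{0,1\}^{\binom{n}{k}}\rightarrow\{0,1\}$ by the $k$-element subsets $S$ of $[n]=\{1,\dots,n\}$ (so an input $x=(x_S)_S$ encodes a $k$-uniform hypergraph on vertex set $[n]$). The function $f$ is called a $k$-uniform hypergraph property if for every input $x=(x_S)_S$ and every permutation $\sigma\in S_n$, $f((x_S)_S)=f((x_{\sigma(S)})_S)$, where $\sigma(S)=\{\sigma(i) : i\in S\}$. -}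

module Defs where

open import Data.Nat.Properties using (≡-irrelevant; suc-injective; +-0-commutativeMonoid)
open import Algebra.Properties.CommutativeMonoid.Sum +-0-commutativeMonoid
  using (sum; sum-permute)
open import Data.Bool.Base using (Bool; true; false; not; if_then_else_)
import Data.Bool.Properties as Bool
open import Data.Fin.Base using (Fin; zero; suc)
open import Data.Fin.Permutation as Perm
  using (Permutation′; _⟨$⟩ʳ_; _⟨$⟩ˡ_; inverseˡ; inverseʳ; cast-id)
open import Data.Fin.Properties using (+↔⊎)
open import Data.Fin.Subset using (Subset; inside; outside; ∣_∣; _∈_; ⊥)
open import Data.Fin.Subset.Properties using (∣⊥∣≡0)
open import Data.List.Base as List using (List; []; _∷_; cartesianProductWith)
open import Data.List.Extrema.Nat using (max)
open import Data.List.Membership.Propositional using () renaming (_∈_ to _∈ˡ_)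
open import Data.List.Membership.Propositional.Properties using (∈-cartesianProductWith⁺)
open import Data.List.Relation.Unary.Any using (here; there)
open import Data.Nat.Base using (ℕ; zero; suc; _+_; _/_)
open import Data.Nat.Combinatorics using (_C_; nCk+nC[k+1]≡[n+1]C[k+1])
open import Data.Product using (Σ-syntax; ∃-syntax; _×_; _,_; proj₁)
open import Data.Sum.Base using (_⊎_; inj₁; inj₂)
open import Data.Sum.Function.Propositional using (_⊎-↔_)
open import Data.Vec.Base as Vec using (Vec; []; _∷_; lookup; tabulate; updateAt)
open import Data.Vec.Properties
  using (lookup∘tabulate; tabulate∘lookup; []=⇒lookup; lookup⇒[]=)
open import Function.Base using (_∘_)
open import Function.Bundles using (_↔_; _⇔_; mk↔ₛ′; mk⇔; Inverse)
open import Function.Construct.Composition using (_↔-∘_)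
open import Relation.Binary.PropositionalEquality
  using (_≡_; _≢_; refl; sym; trans; cong; module ≡-Reasoning)
open import Relation.Nullary.Decidable using (¬?)

------------------------------------------------------------------------
-- Boolean functions and sensitivity

BooleanFunction : ℕ → Set
BooleanFunction N = Vec Bool N → Bool

NonConstant : ∀ {N} → BooleanFunction N → Set
NonConstant f = ∃[ x ] ∃[ y ] f x ≢ f y

flipBit : ∀ {N} → Fin N → Vec Bool N → Vec Bool N
flipBit i x = updateAt x i not

sensitivityAt : ∀ {N} → BooleanFunction N → Vec Bool N → ℕ
sensitivityAt {N} f x =
  List.length (List.filter (λ i → ¬? (f x Bool.≟ f (flipBit i x))) (List.allFin N))

allInputs : ∀ N → List (Vec Bool N)
allInputs zero    = [] ∷ []
allInputs (suc N) = cartesianProductWith _∷_ (false ∷ true ∷ []) (allInputs N)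

∈-allInputs : ∀ {N} (x : Vec Bool N) → x ∈ˡ allInputs N
∈-allInputs []          = here refl
∈-allInputs (false ∷ x) =
  ∈-cartesianProductWith⁺ _∷_ {xs = false ∷ true ∷ []} (here refl) (∈-allInputs x)
∈-allInputs (true ∷ x)  =
  ∈-cartesianProductWith⁺ _∷_ {xs = false ∷ true ∷ []} (there (here refl)) (∈-allInputs x)

sensitivity : ∀ {N} → BooleanFunction N → ℕ
sensitivity {N} f = max 0 (List.map (sensitivityAt f) (allInputs N))

------------------------------------------------------------------------
-- The k-element subsets of an n-element set

KSubset : ℕ → ℕ → Set
KSubset n k = Σ[ S ∈ Subset n ] ∣ S ∣ ≡ k

KSubset-≡ : ∀ {n k} {S T : KSubset n k} → proj₁ S ≡ proj₁ T → S ≡ T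
KSubset-≡ {S = S , p} {.S , q} refl = cong (S ,_) (≡-irrelevant p q)

∣S∣≡0⇒S≡⊥ : ∀ {n} (S : Subset n) → ∣ S ∣ ≡ 0 → S ≡ ⊥
∣S∣≡0⇒S≡⊥ []            _  = refl
∣S∣≡0⇒S≡⊥ (outside ∷ S) eq = cong (outside ∷_) (∣S∣≡0⇒S≡⊥ S eq)

-- Pascal's rule: a subset of size k + 1 either contains the first point or not.
KSubset-pascal : ∀ {n k} → (KSubset n k ⊎ KSubset n (suc k)) ↔ KSubset (suc n) (suc k)
KSubset-pascal {n} {k} = mk↔ₛ′ to from to∘from from∘to
  where
  to : KSubset n k ⊎ KSubset n (suc k) → KSubset (suc n) (suc k)
  to (inj₁ (S , p)) = inside ∷ S , cong suc p
  to (inj₂ (S , p)) = outside ∷ S , p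

  from : KSubset (suc n) (suc k) → KSubset n k ⊎ KSubset n (suc k)
  from (inside ∷ S , p)  = inj₁ (S , suc-injective p)
  from (outside ∷ S , p) = inj₂ (S , p)

  to∘from : ∀ S → to (from S) ≡ S
  to∘from (inside ∷ S , p)  = KSubset-≡ refl
  to∘from (outside ∷ S , p) = refl

  from∘to : ∀ S → from (to S) ≡ S
  from∘to (inj₁ (S , p)) = cong inj₁ (KSubset-≡ refl)
  from∘to (inj₂ (S , p)) = refl

-- The indexing of the n C k variables by k-element subsets.  Which bijection is
-- chosen is immaterial to the notions below.
indexing : ∀ n k → Fin (n C k) ↔ KSubset n k
indexing n zero = mk↔ₛ′
  (λ _ → ⊥ , ∣⊥∣≡0 n) (λ _ → zero)
  (λ (S , p) → KSubset-≡ (sym (∣S∣≡0⇒S≡⊥ S p)))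
  (λ { zero → refl })
indexing zero    (suc k) = mk↔ₛ′ (λ ()) (λ { ([] , ()) }) (λ { ([] , ()) }) (λ ())
indexing (suc n) (suc k) =
  KSubset-pascal ↔-∘ ((indexing n k ⊎-↔ indexing n (suc k)) ↔-∘ (+↔⊎
    ↔-∘ cast-id (sym (nCk+nC[k+1]≡[n+1]C[k+1] n k))))

subsetAt : ∀ {n k} → Fin (n C k) → KSubset n k
subsetAt {n} {k} = Inverse.to (indexing n k)

indexOf : ∀ {n k} → KSubset n k → Fin (n C k)
indexOf {n} {k} = Inverse.from (indexing n k)

------------------------------------------------------------------------
-- The action of permutations

-- j ∈ σ(S) iff σ⁻¹(j) ∈ S; ∈-image confirms σ(S) = { σ(i) : i ∈ S }.
image : ∀ {n} → Permutation′ n → Subset n → Subset n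
image σ S = tabulate (λ j → lookup S (σ ⟨$⟩ˡ j))

∈-image : ∀ {n} (σ : Permutation′ n) (S : Subset n) (j : Fin n) →
          j ∈ image σ S ⇔ (∃[ i ] i ∈ S × σ ⟨$⟩ʳ i ≡ j)
∈-image σ S j = mk⇔ to from
  where
  lookup-image : ∀ j → lookup (image σ S) j ≡ lookup S (σ ⟨$⟩ˡ j)
  lookup-image = lookup∘tabulate _

  to : j ∈ image σ S → ∃[ i ] i ∈ S × σ ⟨$⟩ʳ i ≡ j
  to j∈ = σ ⟨$⟩ˡ j
        , lookup⇒[]= _ S (trans (sym (lookup-image j)) ([]=⇒lookup j∈))
        , inverseʳ σ

  from : (∃[ i ] i ∈ S × σ ⟨$⟩ʳ i ≡ j) → j ∈ image σ S
  from (i , i∈S , refl) = lookup⇒[]= _ (image σ S)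
    (trans (lookup-image _) (trans (cong (lookup S) (inverseˡ σ)) ([]=⇒lookup i∈S)))

∣image∣ : ∀ {n} (σ : Permutation′ n) (S : Subset n) → ∣ image σ S ∣ ≡ ∣ S ∣
∣image∣ {n} σ S = begin
  ∣ image σ S ∣                        ≡⟨ ∣tabulate∣ (λ j → lookup S (σ ⟨$⟩ˡ j)) ⟩
  sum (λ j → bit (lookup S (σ ⟨$⟩ˡ j))) ≡⟨ sum-permute (bit ∘ lookup S) (Perm.flip σ) ⟨
  sum (bit ∘ lookup S)                 ≡⟨ ∣tabulate∣ (lookup S) ⟨
  ∣ tabulate (lookup S) ∣              ≡⟨ cong ∣_∣ (tabulate∘lookup S) ⟩
  ∣ S ∣                                ∎
  where
  open ≡-Reasoning

  bit : Bool → ℕ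
  bit b = if b then 1 else 0

  ∣tabulate∣ : ∀ {m} (g : Fin m → Bool) → ∣ tabulate g ∣ ≡ sum (bit ∘ g)
  ∣tabulate∣ {zero}  g = refl
  ∣tabulate∣ {suc m} g with g zero
  ... | true  = cong suc (∣tabulate∣ (g ∘ suc))
  ... | false = ∣tabulate∣ (g ∘ suc)

imageₖ : ∀ {n k} → Permutation′ n → KSubset n k → KSubset n k
imageₖ σ (S , p) = image σ S , trans (∣image∣ σ S) p

------------------------------------------------------------------------
-- Hypergraph properties

-- The input (x_{σ(S)})_S.
permute : ∀ {n k} → Permutation′ n → Vec Bool (n C k) → Vec Bool (n C k)
permute {n} {k} σ x =
  tabulate (λ i → lookup x (indexOf {n} {k} (imageₖ σ (subsetAt {n} {k} i))))

IsHypergraphProperty : ∀ n k → BooleanFunction (n C k) → Set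
IsHypergraphProperty n k f =
  ∀ (x : Vec Bool (n C k)) (σ : Permutation′ n) → f x ≡ f (permute {n} {k} σ x)

⌈_/3⌉ : ℕ → ℕ
⌈ k /3⌉ = (k + 2) / 3

{-# OPTIONS --safe #-}
module Submission where

open import Data.Nat.Base using (ℕ; _*_; _^_; _∸_; _%_; _≤_; _<_)
open import Data.Nat.Combinatorics using (_C_)
open import Data.Product using (Σ-syntax; ∃-syntax; _×_)
open import Relation.Binary.PropositionalEquality using (_≡_)
open import Defs

-- Let k = 3 m + 1.  The property asks for a copy of a pattern: m core vertices, one apex,
-- m wing and constantly many base vertices, and about √n poles.  It prescribes O(√n · n ^ m)
-- edges: they contain the core and at least m further apex, wing or base vertices, and all
-- but O(n) of them, the marks of the non-poles, contain a pole.  This bounds the sensitivity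
-- where the property holds.
--
-- Where it fails, every sensitive edge e comes with a pattern whose only mismatch is e.  The
-- prescriptions are chosen so that two patterns with the same core and a common pole b
-- disagree on some edge through b, unless apex, wing and base coincide; if these coincide
-- but the poles do not, the patterns disagree on a mark different from both mismatches.  So
-- e is determined by the core and any pole outside e, and double counting gives at most
-- n ^ m · n / √n sensitive edges.

open import Data.Nat.Properties as ℕ hiding (_≟_; suc-injective)
open import Algebra.Properties.CommutativeMonoid.Sum +-0-commutativeMonoid
  using (sum; sum-cong-≗; sum-permute; sum-replicate-zero; ∑-comm; ∑-distrib-+)
open import Algebra.Properties.CommutativeSemigroup +-commutativeSemigroup using (x∙yz≈y∙xz)
open import Data.Bool.Base using (Bool; true; false; not; _∧_; _∨_; if_then_else_)
open import Data.Bool.Properties as Bool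
  using (∧-zeroʳ; ∧-identityʳ; ∧-assoc; ∧-comm; not-involutive)
open import Data.Fin.Base using (Fin; zero; suc; combine; remQuot; inject₁)
open import Data.Fin.Patterns
open import Data.Fin.Permutation as Perm using (Permutation′; _⟨$⟩ʳ_; _⟨$⟩ˡ_; inverseˡ; inverseʳ)
open import Data.Fin.Properties
  using (_≟_; suc-injective; any?; all?; injective⇒≤; combine-injective; combine-remQuot)
open import Data.Fin.Subset using (Subset; ∣_∣; ⊥)
open import Data.Fin.Subset.Properties using (∣⊥∣≡0)
open import Data.List.Base as List
  using (List; []; _∷_; _++_; length; map; filter; allFin; cartesianProductWith)
open import Data.List.Extrema.Nat using (max≤v⁺)
open import Data.List.Membership.Propositional using (_∈_)
open import Data.List.Membership.Propositional.Properties
  using (∈-map⁺; ∈-++⁺ˡ; ∈-++⁺ʳ; ∈-cartesianProductWith⁺; ∈-filter⁺; ∈-allFin)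
open import Data.List.Membership.Setoid.Properties using (index-injective)
open import Data.List.Properties using (length-map; length-++)
import Data.List.Relation.Unary.All as All
import Data.List.Relation.Unary.All.Properties as All
open import Data.List.Relation.Unary.Any using (here; index)
open import Data.Nat.Base
  using (zero; suc; _+_; _/_; z≤n; s≤s; s≤s⁻¹; >-nonZero)
open import Data.Nat.Combinatorics using (nCk+nC[k+1]≡[n+1]C[k+1])
open import Data.Nat.DivMod using (m*n/n≡m; m≡m%n+[m/n]*n)
open import Data.Nat.Tactic.RingSolver using (solve)
open import Data.Product using (_,_; proj₁; proj₂; uncurry; ∃)
open import Data.Product.Properties using (,-injective)
open import Data.Sum.Base using (_⊎_; inj₁; inj₂; [_,_]′)
open import Data.Vec.Base as Vec using (Vec; lookup; tabulate; replicate; _[_]≔_)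
open import Data.Vec.Properties
  using (lookup∘updateAt; lookup∘updateAt′; lookup∘tabulate; tabulate∘lookup; tabulate-cong;
         lookup-replicate; []≔-idempotent; []≔-lookup)
open import Function.Base using (_∘_; const; flip; id)
open import Function.Bundles using (Inverse)
open import Function.Definitions using (Injective)
open import Relation.Binary.Definitions using (DecidableEquality)
open import Relation.Binary.PropositionalEquality
  using (refl; sym; trans; cong; cong₂; subst; _≢_; setoid; module ≡-Reasoning)
open import Relation.Nullary using (Dec; does; yes; no; contradiction; ¬_)
open import Relation.Nullary.Decidable
  using (dec-true; dec-false; map′; _×-dec_; _⊎-dec_; _→-dec_; ¬?; decidable-stable)
open import Relation.Unary using (Decidable)

-- The split k = 3 m + 1 is a balance. A typical prescribed edge has m core vertices, m body
-- vertices (apex, wing or base), m free ones and a pole. With s poles a pattern prescribes about s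
-- · n ^ m edges, while core and pole leave about n ^ (m + 1) / s near misses, so s is taken near
-- √n. The obstacle is to detect every change of apex, wing or base by edges that have, besides one
-- pole, at most m vertices outside the placed ones. Two body sizes serve for this. With m body
-- vertices an edge is present exactly when it contains the apex; with m + 1 the rule is reversed,
-- so an edge betrays a body vertex that only one pattern counts. The one exception to the reversal,
-- the apex with the whole wing and no base vertex, is present and tells wing from base. The base is
-- so large that two bases share m vertices, or each has m vertices that are free for the other
-- pattern. Comparing two patterns thus comes down to finitely many tables of counts, one for each
-- kind of discrepancy.

infix 4 _==_

_==_ : ∀ {r} → Fin r → Fin r → Bool
i == j = does (i ≟ j)

==-refl : ∀ {r} (i : Fin r) → (i == i) ≡ true
==-refl i = dec-true (i ≟ i) refl

does-true : ∀ {A : Set} (a? : Dec A) → does a? ≡ true → A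
does-true (yes a) _ = a

==-sound : ∀ {r} {i j : Fin r} → (i == j) ≡ true → i ≡ j
==-sound {i = i} {j} = does-true (i ≟ j)

∧-true : ∀ {a b} → a ∧ b ≡ true → a ≡ true × b ≡ true
∧-true {true} {true} _ = refl , refl

true≢false : ∀ {b} → b ≡ true → b ≢ false
true≢false refl ()

-- Counting vertices by Boolean tests, and choosing vertices by quota

bit : Bool → ℕ
bit b = if b then 1 else 0

# : ∀ {n} → (Fin n → Bool) → ℕ
# p = sum (bit ∘ p)

#-cong : ∀ {n} {p q : Fin n → Bool} → (∀ v → p v ≡ q v) → # p ≡ # q
#-cong p≗q = sum-cong-≗ (cong bit ∘ p≗q)

sum-mono-≤ : ∀ {n} {f g : Fin n → ℕ} → (∀ v → f v ≤ g v) → sum f ≤ sum g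
sum-mono-≤ {zero}  f≤g = z≤n
sum-mono-≤ {suc n} f≤g = +-mono-≤ (f≤g zero) (sum-mono-≤ (f≤g ∘ suc))

t[i]≤sum : ∀ {n} (t : Fin n → ℕ) i → t i ≤ sum t
t[i]≤sum t zero    = m≤m+n _ _
t[i]≤sum t (suc i) = ≤-trans (t[i]≤sum (t ∘ suc) i) (m≤n+m _ _)

bit-mono : ∀ {a b} → (a ≡ true → b ≡ true) → bit a ≤ bit b
bit-mono {false}         _  = z≤n
bit-mono {true}  {true}  _  = ≤-refl
bit-mono {true}  {false} ab = contradiction (ab refl) λ ()

#-mono : ∀ {n} {p q : Fin n → Bool} → (∀ v → p v ≡ true → q v ≡ true) → # p ≤ # q
#-mono p⇒q = sum-mono-≤ (bit-mono ∘ p⇒q)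

#-none : ∀ {n} {p : Fin n → Bool} → (∀ v → p v ≡ false) → # p ≡ 0
#-none {n} none = trans (#-cong none) (sum-replicate-zero n)

#-all : ∀ n → # {n} (const true) ≡ n
#-all zero    = refl
#-all (suc n) = cong suc (#-all n)

#-positive : ∀ {n} {p : Fin n → Bool} {v} → p v ≡ true → 1 ≤ # p
#-positive {p = p} {v} pv = ≤-trans (≤-reflexive (sym (cong bit pv))) (t[i]≤sum (bit ∘ p) v)

#-permute : ∀ {n} (p : Fin n → Bool) (σ : Permutation′ n) → # (p ∘ (σ ⟨$⟩ʳ_)) ≡ # p
#-permute p σ = sym (sum-permute (bit ∘ p) σ)

#-complement : ∀ {n} (p q : Fin n → Bool) → # p ≡ # (λ v → p v ∧ q v) + # (λ v → p v ∧ not (q v))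
#-complement p q = trans (sum-cong-≗ (λ v → pointwise (p v) (q v)))
  (∑-distrib-+ (λ v → bit (p v ∧ q v)) (λ v → bit (p v ∧ not (q v))))
  where
  pointwise : ∀ a b → bit a ≡ bit (a ∧ b) + bit (a ∧ not b)
  pointwise false _     = refl
  pointwise true  false = refl
  pointwise true  true  = refl

sum-== : ∀ {r} (i : Fin r) → sum (λ j → bit (i == j)) ≡ 1
sum-== {suc r} zero    = cong suc (#-none {r} {λ j → zero == suc j} (λ _ → refl))
sum-== {suc r} (suc i) = trans (sum-cong-≗ (λ j → cong bit (suc-== i j))) (sum-== i)
  where
  suc-== : ∀ (i j : Fin r) → (suc i == suc j) ≡ (i == j)
  suc-== i j with i ≟ j
  ... | yes _ = refl
  ... | no  _ = refl

#-split : ∀ {n r} (p : Fin n → Bool) (g : Fin n → Fin r) →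
          # p ≡ sum (λ j → # (λ v → p v ∧ (g v == j)))
#-split {r = r} p g = trans (sum-cong-≗ pointwise) (∑-comm (λ v j → bit (p v ∧ (g v == j))))
  where
  pointwise : ∀ v → bit (p v) ≡ sum (λ j → bit (p v ∧ (g v == j)))
  pointwise v with p v
  ... | true  = sym (sum-== (g v))
  ... | false = sym (sum-replicate-zero r)

∣∣≡# : ∀ {n} (S : Subset n) → ∣ S ∣ ≡ # (lookup S)
∣∣≡# Vec.[]          = refl
∣∣≡# (true Vec.∷ S)  = cong suc (∣∣≡# S)
∣∣≡# (false Vec.∷ S) = ∣∣≡# S

enumerate : ∀ {n r} (p : Fin n → Bool) → r ≤ # p →
            Σ[ g ∈ (Fin r → Fin n) ] Injective _≡_ _≡_ g × (∀ j → p (g j) ≡ true)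
enumerate {zero}  p z≤n = (λ ()) , (λ { {()} }) , λ ()
enumerate {suc n} {r} p r≤ with p zero in p0
... | false with g , inj , ok ← enumerate (p ∘ suc) r≤ =
  suc ∘ g , inj ∘ suc-injective , ok
... | true with r | r≤
...   | zero   | _      = (λ ()) , (λ { {()} }) , λ ()
...   | suc r′ | s≤s r≤′ with g , inj , ok ← enumerate (p ∘ suc) r≤′ =
  g⁺ , inj⁺ , λ { zero → p0 ; (suc j) → ok j }
  where
  g⁺ : Fin (suc r′) → Fin (suc n)
  g⁺ zero    = zero
  g⁺ (suc j) = suc (g j)

  inj⁺ : Injective _≡_ _≡_ g⁺
  inj⁺ {zero}  {zero}  _  = refl
  inj⁺ {suc i} {suc j} eq = cong suc (inj (suc-injective eq))

#-witness : ∀ {n} {p : Fin n → Bool} → 1 ≤ # p → ∃[ v ] p v ≡ true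
#-witness {p = p} 1≤#p with g , _ , ok ← enumerate p 1≤#p = g zero , ok zero

#-insert : ∀ {n} (S : Subset n) (p : Fin n → Bool) v → lookup S v ≡ false →
           # (λ u → lookup (S [ v ]≔ true) u ∧ p u) ≡ bit (p v) + # (λ u → lookup S u ∧ p u)
#-insert (false Vec.∷ S) p zero    _   = refl
#-insert (x Vec.∷ S)     p (suc v) v∉S = trans
  (cong (bit (x ∧ p zero) +_) (#-insert S (p ∘ suc) v v∉S))
  (x∙yz≈y∙xz (bit (x ∧ p zero)) (bit (p (suc v))) _)

module _ {K : Set} (_≟K_ : DecidableEquality K) where

  -- Greedy choice: a vertex passing p is taken as long as its class has quota left. Taking it
  -- lowers quota and supply of the class together, and it is skipped only at quota zero, so the
  -- supply stays sufficient. All edges of prescribed profile are built this way.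
  select : ∀ {n} (p : Fin n → Bool) (κ : Fin n → K) (t : K → ℕ) →
           (∀ j → t j ≤ # (λ v → p v ∧ does (κ v ≟K j))) →
           Σ[ S ∈ Subset n ] (∀ v → lookup S v ≡ true → p v ≡ true) ×
             (∀ j → # (λ v → lookup S v ∧ does (κ v ≟K j)) ≡ t j)
  select {zero}  p κ t t≤ = Vec.[] , (λ ()) , λ j → sym (n≤0⇒n≡0 (t≤ j))
  select {suc n} p κ t t≤ with p zero in p0
  ... | false with S , S⊆p , ok ← select (p ∘ suc) (κ ∘ suc) t t≤ =
    false Vec.∷ S , (λ { zero () ; (suc v) → S⊆p v }) , ok
  ... | true with t (κ zero) in t0
  ...   | zero = false Vec.∷ S , (λ { zero () ; (suc v) → S⊆p v }) , ok
    where
    t≤′ : ∀ j → t j ≤ # (λ v → p (suc v) ∧ does (κ (suc v) ≟K j))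
    t≤′ j with κ zero ≟K j | t≤ j
    ... | yes refl | _  = subst (_≤ _) (sym t0) z≤n
    ... | no  _    | le = le

    rec = select (p ∘ suc) (κ ∘ suc) t t≤′
    S   = proj₁ rec
    S⊆p = proj₁ (proj₂ rec)
    ok  = proj₂ (proj₂ rec)
  ...   | suc a = true Vec.∷ S , (λ { zero _ → p0 ; (suc v) → S⊆p v }) , ok⁺
    where
    δ : K → ℕ
    δ j = bit (does (κ zero ≟K j))

    δ≤t : ∀ j → δ j ≤ t j
    δ≤t j with κ zero ≟K j
    ... | yes refl = subst (1 ≤_) (sym t0) (s≤s z≤n)
    ... | no  _    = z≤n

    rec = select (p ∘ suc) (κ ∘ suc) (λ j → t j ∸ δ j) (λ j → m≤n+o⇒m∸n≤o _ (δ j) (t≤ j))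
    S   = proj₁ rec
    S⊆p = proj₁ (proj₂ rec)

    ok⁺ : ∀ j → δ j + # (λ v → lookup S v ∧ does (κ (suc v) ≟K j)) ≡ t j
    ok⁺ j = trans (cong (δ j +_) (proj₂ (proj₂ rec) j)) (m+[n∸m]≡n (δ≤t j))

-- Separating two patterns

-- Roles are numbered 0F core, 1F apex, 2F wing, 3F base, 4F free, 5F pole.  A profile counts
-- vertices by role, with the poles thrown in with the free vertices.
Profile : Set
Profile = Fin 5 → ℕ

body : Profile → ℕ
body p = p 1F + (p 2F + p 3F)

-- Among the edges with a pole, a pattern prescribes those with a positive profile to be
-- present and those with a negative one to be absent.  A mark edge is present or absent
-- according to whether it has a pole, so that the marks reveal the poles.
Mark Positive Negative : ℕ → Profile → Set
Mark m p = p 3F ≡ 2 * m × p 1F + p 2F ≡ 0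
Positive m p = p 0F ≡ m ×
  ((body p ≡ m × p 1F ≡ 1) ⊎ (body p ≡ suc m × (p 1F ≡ 0 ⊎ p 3F ≡ 0)) ⊎ Mark m p)
Negative m p = p 0F ≡ m ×
  ((body p ≡ m × p 1F ≡ 0) ⊎ (body p ≡ suc m × p 1F ≡ 1 × 1 ≤ p 3F))

-- The (i , j) entry counts vertices of role i for one pattern and role j for another.
Table : Set
Table = Fin 5 → Fin 5 → ℕ

rows cols : Table → Profile
rows t i = sum (t i)
cols t = rows (flip t)

Separating : ℕ → Table → Set
Separating m t = (Positive m (rows t) × Negative m (cols t)) ⊎
                 (Negative m (rows t) × Positive m (cols t))

-- An edge through a common pole on which the two patterns disagree, described by the number
-- of its other vertices in each cell of the table N.
record Quota (m : ℕ) (N : Table) : Set where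
  constructor quota
  field
    amount     : Table
    fits       : ∀ i j → amount i j ≤ N i j
    total      : sum (rows amount) ≡ 3 * m
    separating : Separating m amount

-- What always holds for two patterns with equal cores and a common pole. That pole is left out of
-- the table; it has class 4F, so the rows and columns 0F to 3F keep their full sizes.
record Overlap (m : ℕ) (N : Table) : Set where
  field
    core-core : m ≤ N 0F 0F
    free-free : m ≤ N 4F 4F
    core-row  : ∀ j → j ≢ 0F → N 0F j ≡ 0
    core-col  : ∀ i → i ≢ 0F → N i 0F ≡ 0
    row₁ : rows N 1F ≡ 1
    col₁ : cols N 1F ≡ 1
    row₂ : rows N 2F ≡ m
    col₂ : cols N 2F ≡ m
    row₃ : 3 * m < rows N 3F
    col₃ : 3 * m < cols N 3F

flip-quota : ∀ {m N} → Quota m (flip N) → Quota m N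
flip-quota (quota t fits total sep) = quota (flip t) (flip fits)
  (trans (∑-comm (flip t)) total) (swap sep)
  where
  swap : Separating _ t → Separating _ (flip t)
  swap (inj₁ (p , n)) = inj₂ (n , p)
  swap (inj₂ (n , p)) = inj₁ (p , n)

flip-overlap : ∀ {m N} → Overlap m N → Overlap m (flip N)
flip-overlap o = record
  { core-core = core-core ; free-free = free-free ; core-row = core-col ; core-col = core-row
  ; row₁ = col₁ ; col₁ = row₁ ; row₂ = col₂ ; col₂ = row₂ ; row₃ = col₃ ; col₃ = row₃ }
  where open Overlap o

infixr 5 _↦_∷_

-- Listing the nonzero cells over `none` lets row and column sums compute, up to trailing zeros.
_↦_∷_ : Fin 5 × Fin 5 → ℕ → Table → Table
((i , j) ↦ a ∷ t) i′ j′ = if (i == i′) ∧ (j == j′) then a else t i′ j′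

none : Table
none _ _ = 0

module Within (N : Table) where

  infixr 5 _∷≤_

  _∷≤_ : ∀ {i j a t} → a ≤ N i j → (∀ i′ j′ → t i′ j′ ≤ N i′ j′) →
         ∀ i′ j′ → ((i , j) ↦ a ∷ t) i′ j′ ≤ N i′ j′
  _∷≤_ {i} {j} a≤ t≤ i′ j′ with i ≟ i′ | j ≟ j′
  ... | yes refl | yes refl = a≤
  ... | yes _    | no  _    = t≤ i′ j′
  ... | no  _    | _        = t≤ i′ j′

  all-of : ∀ i j {t} → (∀ i′ j′ → t i′ j′ ≤ N i′ j′) →
           ∀ i′ j′ → ((i , j) ↦ N i j ∷ t) i′ j′ ≤ N i′ j′
  all-of i j t≤ = _∷≤_ {i} {j} ≤-refl t≤

  none≤ : ∀ i j → none i j ≤ N i j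
  none≤ _ _ = z≤n

t[i]+t[j]≤sum : ∀ {n} (t : Fin n → ℕ) {i j} → i ≢ j → t i + t j ≤ sum t
t[i]+t[j]≤sum t {zero}  {zero}  i≢j = contradiction refl i≢j
t[i]+t[j]≤sum t {zero}  {suc j} i≢j = +-monoʳ-≤ (t zero) (t[i]≤sum (t ∘ suc) j)
t[i]+t[j]≤sum t {suc i} {zero}  i≢j =
  subst (_≤ sum t) (+-comm (t zero) (t (suc i))) (+-monoʳ-≤ (t zero) (t[i]≤sum (t ∘ suc) i))
t[i]+t[j]≤sum t {suc i} {suc j} i≢j =
  ≤-trans (t[i]+t[j]≤sum (t ∘ suc) (i≢j ∘ cong suc)) (m≤n+m _ _)

sum≡1⇒unique : ∀ {n} (t : Fin n → ℕ) {i} → sum t ≡ 1 → 1 ≤ t i → ∀ j → j ≢ i → t j ≡ 0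
sum≡1⇒unique t {i} eq 1≤ j j≢i =
  n≤0⇒n≡0 (+-cancelˡ-≤ 1 _ _ (≤-trans (+-monoˡ-≤ (t j) 1≤)
    (subst (t i + t j ≤_) eq (t[i]+t[j]≤sum t (j≢i ∘ sym)))))

zero⊎positive : ∀ a → a ≡ 0 ⊎ 1 ≤ a
zero⊎positive zero    = inj₁ refl
zero⊎positive (suc _) = inj₂ (s≤s z≤n)

module _ {l : ℕ} {N : Table} (o : Overlap (suc l) N) where

  open Overlap o

  -- Of the first base, no vertex is core, at most one is apex and at most m are wing for the second
  -- pattern. At least 2 m - 1 of its vertices remain for the two cells, so one of these has m.
  base-dichotomy : suc l ≤ N 3F 3F ⊎ suc l ≤ N 3F 4F
  base-dichotomy with ≤-<-connex (suc l) (N 3F 3F)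
  ... | inj₁ big   = inj₁ big
  ... | inj₂ small = inj₂ (+-cancelˡ-≤ (1 + (suc l + l)) _ _ (begin
    1 + (suc l + l) + suc l                           ≡⟨ solve (l ∷ []) ⟩
    3 * suc l                                         ≤⟨ <⇒≤ row₃ ⟩
    N 3F 0F + (N 3F 1F + (N 3F 2F + (N 3F 3F + (N 3F 4F + 0))))
      ≤⟨ +-mono-≤ (≤-reflexive (core-col 3F λ ()))
        (+-mono-≤ (subst (N 3F 1F ≤_) col₁ (t[i]≤sum (flip N 1F) 3F))
        (+-mono-≤ (subst (N 3F 2F ≤_) col₂ (t[i]≤sum (flip N 2F) 3F))
        (+-monoˡ-≤ (N 3F 4F + 0) (s≤s⁻¹ small)))) ⟩
    0 + (1 + (suc l + (l + (N 3F 4F + 0))))           ≡⟨ regroup (N 3F 4F) ⟩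
    1 + (suc l + l) + N 3F 4F                         ∎))
    where
    open ≤-Reasoning
    regroup : ∀ x → 0 + (1 + (suc l + (l + (x + 0)))) ≡ 1 + (suc l + l) + x
    regroup x = solve (x ∷ l ∷ [])

  open Within N

  private
    l+0 : l + 0 ≡ l
    l+0 = +-identityʳ l

    core! : suc l + 0 ≡ suc l
    core! = cong suc l+0

    keep-middle : ∀ c d {a b e s} → a + (b + (c + (d + (e + 0)))) ≡ s →
                  a ≡ 0 → b ≡ 0 → e ≡ 0 → c + (d + 0) ≡ s
    keep-middle _ _ eq refl refl refl = eq

    pad : ∀ a b → a + 0 + (b + 0) ≡ a + (b + 0)
    pad a b = cong (_+ (b + 0)) (+-identityʳ a)

  -- With m = `suc l`, the common apex is joined by l base vertices of the first pattern and m of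
  -- the second. The bodies have sizes m and m + 1, between which the apex rule is reversed.
  same-apex-small : 1 ≤ N 1F 1F → suc l ≤ N 3F 4F → suc l ≤ N 4F 3F → Quota (suc l) N
  same-apex-small 11+ 34+ 43+ = quota
    ((0F , 0F) ↦ suc l ∷ (1F , 1F) ↦ 1 ∷ (3F , 4F) ↦ l ∷ (4F , 3F) ↦ suc l ∷ none)
    (core-core ∷≤ 11+ ∷≤ <⇒≤ 34+ ∷≤ 43+ ∷≤ none≤)
    total
    (inj₁ ((core! , inj₁ (cong suc l+0 , refl)) ,
           (core! , inj₂ (cong (2 +_) l+0 , refl , s≤s z≤n))))
    where
    total : suc l + 0 + (1 + (0 + (l + 0 + (suc l + 0 + 0)))) ≡ 3 * suc l
    total = solve (l ∷ [])

  -- Without an apex, m common base vertices make the edge absent for the first pattern; a vertex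
  -- that is body only for the second raises its body to m + 1, which makes the edge present.
  same-apex-big : suc l ≤ N 3F 3F → 1 ≤ N 4F 2F ⊎ 1 ≤ N 4F 3F → Quota (suc l) N
  same-apex-big 33+ (inj₁ 42+) = quota
    ((0F , 0F) ↦ suc l ∷ (4F , 2F) ↦ 1 ∷ (3F , 3F) ↦ suc l ∷ (4F , 4F) ↦ l ∷ none)
    (core-core ∷≤ 42+ ∷≤ 33+ ∷≤ <⇒≤ free-free ∷≤ none≤)
    total
    (inj₂ ((core! , inj₁ (core! , refl)) , (core! , inj₂ (inj₁ (cong suc core! , inj₁ refl)))))
    where
    total : suc l + 0 + (0 + (0 + (suc l + 0 + (1 + (l + 0) + 0)))) ≡ 3 * suc l
    total = solve (l ∷ [])
  same-apex-big 33+ (inj₂ 43+) = quota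
    ((0F , 0F) ↦ suc l ∷ (4F , 3F) ↦ 1 ∷ (3F , 3F) ↦ suc l ∷ (4F , 4F) ↦ l ∷ none)
    (core-core ∷≤ 43+ ∷≤ 33+ ∷≤ <⇒≤ free-free ∷≤ none≤)
    total
    (inj₂ ((core! , inj₁ (core! , refl)) , (core! , inj₂ (inj₁ (cong suc l+1 , inj₁ refl)))))
    where
    total : suc l + 0 + (0 + (0 + (suc l + 0 + (1 + (l + 0) + 0)))) ≡ 3 * suc l
    total = solve (l ∷ [])

    l+1 : l + 1 ≡ suc l
    l+1 = +-comm l 1

  -- The apex with the whole first wing is the exceptional present edge of the first pattern. For
  -- the second the body also has size m + 1, but it contains a base vertex, so the edge is absent.
  same-apex-wing : 1 ≤ N 1F 1F → N 2F 4F ≡ 0 → 1 ≤ N 2F 3F → Quota (suc l) N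
  same-apex-wing 11+ 24≡0 23+ = quota
    ((0F , 0F) ↦ suc l ∷ (1F , 1F) ↦ 1 ∷ (2F , 2F) ↦ N 2F 2F ∷ (2F , 3F) ↦ N 2F 3F ∷
     (4F , 4F) ↦ l ∷ none)
    (core-core ∷≤ 11+ ∷≤ all-of 2F 2F (all-of 2F 3F (<⇒≤ free-free ∷≤ none≤)))
    (trans (cong (λ x → suc l + 0 + (1 + (x + (0 + (l + 0 + 0))))) wings) total)
    (inj₁ ((core! , inj₂ (inj₁ (cong suc (trans (+-identityʳ _) wings) , inj₂ refl))) ,
           (core! , inj₂ (cong suc (trans (pad (N 2F 2F) (N 2F 3F)) wings) , refl , m≤n⇒m≤n+o 0 23+))))
    where
    wings : N 2F 2F + (N 2F 3F + 0) ≡ suc l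
    wings = keep-middle (N 2F 2F) (N 2F 3F) row₂ (core-col 2F λ ()) (sum≡1⇒unique (flip N 1F) col₁ 11+ 2F λ ()) 24≡0

    total : suc l + 0 + (1 + (suc l + (0 + (l + 0 + 0)))) ≡ 3 * suc l
    total = solve (l ∷ [])

  -- Both bodies consist of the first apex and l common base vertices. They have the same size m,
  -- and only the first pattern sees an apex.
  apex-covered-big : suc l ≤ N 3F 3F → 1 ≤ N 1F 2F ⊎ 1 ≤ N 1F 3F → Quota (suc l) N
  apex-covered-big 33+ (inj₁ 12+) = quota
    ((0F , 0F) ↦ suc l ∷ (1F , 2F) ↦ 1 ∷ (3F , 3F) ↦ l ∷ (4F , 4F) ↦ suc l ∷ none)
    (core-core ∷≤ 12+ ∷≤ <⇒≤ 33+ ∷≤ free-free ∷≤ none≤)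
    total
    (inj₁ ((core! , inj₁ (core! , refl)) , (core! , inj₁ (core! , refl))))
    where
    total : suc l + 0 + (1 + (0 + (l + 0 + (suc l + 0 + 0)))) ≡ 3 * suc l
    total = solve (l ∷ [])
  apex-covered-big 33+ (inj₂ 13+) = quota
    ((0F , 0F) ↦ suc l ∷ (1F , 3F) ↦ 1 ∷ (3F , 3F) ↦ l ∷ (4F , 4F) ↦ suc l ∷ none)
    (core-core ∷≤ 13+ ∷≤ <⇒≤ 33+ ∷≤ free-free ∷≤ none≤)
    total
    (inj₁ ((core! , inj₁ (core! , refl)) , (core! , inj₁ (core! , refl))))
    where
    total : suc l + 0 + (1 + (0 + (l + 0 + (suc l + 0 + 0)))) ≡ 3 * suc l
    total = solve (l ∷ [])

  -- As with a large common base, except that each body is completed by l base vertices that are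
  -- free for the other pattern.
  apex-covered-small : suc l ≤ N 3F 4F → suc l ≤ N 4F 3F → 1 ≤ N 1F 2F ⊎ 1 ≤ N 1F 3F →
                       Quota (suc l) N
  apex-covered-small 34+ 43+ (inj₁ 12+) = quota
    ((0F , 0F) ↦ suc l ∷ (1F , 2F) ↦ 1 ∷ (3F , 4F) ↦ l ∷ (4F , 3F) ↦ l ∷ (4F , 4F) ↦ 1 ∷ none)
    (core-core ∷≤ 12+ ∷≤ <⇒≤ 34+ ∷≤ <⇒≤ 43+ ∷≤ ≤-trans (s≤s z≤n) free-free ∷≤ none≤)
    total
    (inj₁ ((core! , inj₁ (core! , refl)) , (core! , inj₁ (core! , refl))))
    where
    total : suc l + 0 + (1 + (0 + (l + 0 + (l + 1 + 0)))) ≡ 3 * suc l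
    total = solve (l ∷ [])
  apex-covered-small 34+ 43+ (inj₂ 13+) = quota
    ((0F , 0F) ↦ suc l ∷ (1F , 3F) ↦ 1 ∷ (3F , 4F) ↦ l ∷ (4F , 3F) ↦ l ∷ (4F , 4F) ↦ 1 ∷ none)
    (core-core ∷≤ 13+ ∷≤ <⇒≤ 34+ ∷≤ <⇒≤ 43+ ∷≤ ≤-trans (s≤s z≤n) free-free ∷≤ none≤)
    total
    (inj₁ ((core! , inj₁ (core! , refl)) , (core! , inj₁ (core! , refl))))
    where
    total : suc l + 0 + (1 + (0 + (l + 0 + (l + 1 + 0)))) ≡ 3 * suc l
    total = solve (l ∷ [])

  -- The first apex does not count towards the second body, which therefore gets m base vertices
  -- against the l of the first.
  apex-free-small : 1 ≤ N 1F 4F → suc l ≤ N 3F 4F → suc l ≤ N 4F 3F → Quota (suc l) N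
  apex-free-small 14+ 34+ 43+ = quota
    ((0F , 0F) ↦ suc l ∷ (1F , 4F) ↦ 1 ∷ (3F , 4F) ↦ l ∷ (4F , 3F) ↦ suc l ∷ none)
    (core-core ∷≤ 14+ ∷≤ <⇒≤ 34+ ∷≤ 43+ ∷≤ none≤)
    total
    (inj₁ ((core! , inj₁ (core! , refl)) , (core! , inj₁ (core! , refl))))
    where
    total : suc l + 0 + (1 + (0 + (l + 0 + (suc l + 0 + 0)))) ≡ 3 * suc l
    total = solve (l ∷ [])

  -- A wing or base vertex of the second pattern that is free for the first makes up for the first
  -- apex, which the second body lacks; l common base vertices complete both bodies to size m.
  apex-free-big : 1 ≤ N 1F 4F → suc l ≤ N 3F 3F → 1 ≤ N 4F 2F ⊎ 1 ≤ N 4F 3F → Quota (suc l) N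
  apex-free-big 14+ 33+ (inj₁ 42+) = quota
    ((0F , 0F) ↦ suc l ∷ (1F , 4F) ↦ 1 ∷ (4F , 2F) ↦ 1 ∷ (3F , 3F) ↦ l ∷ (4F , 4F) ↦ l ∷ none)
    (core-core ∷≤ 14+ ∷≤ 42+ ∷≤ <⇒≤ 33+ ∷≤ <⇒≤ free-free ∷≤ none≤)
    total
    (inj₁ ((core! , inj₁ (core! , refl)) , (core! , inj₁ (core! , refl))))
    where
    total : suc l + 0 + (1 + (0 + (l + 0 + (1 + (l + 0) + 0)))) ≡ 3 * suc l
    total = solve (l ∷ [])
  apex-free-big 14+ 33+ (inj₂ 43+) = quota
    ((0F , 0F) ↦ suc l ∷ (1F , 4F) ↦ 1 ∷ (4F , 3F) ↦ 1 ∷ (3F , 3F) ↦ l ∷ (4F , 4F) ↦ l ∷ none)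
    (core-core ∷≤ 14+ ∷≤ 43+ ∷≤ <⇒≤ 33+ ∷≤ <⇒≤ free-free ∷≤ none≤)
    total
    (inj₁ ((core! , inj₁ (core! , refl)) , (core! , inj₁ (+-comm l 1 , refl))))
    where
    total : suc l + 0 + (1 + (0 + (l + 0 + (1 + (l + 0) + 0)))) ≡ 3 * suc l
    total = solve (l ∷ [])

  -- The second apex with the whole second wing is the exceptional present edge of the second
  -- pattern. The first pattern counts only the wing vertices, which it takes as wing or base: a
  -- body of size m without apex, hence absent.
  apex-free-wing : 1 ≤ N 1F 4F → 1 ≤ N 4F 1F → N 4F 2F ≡ 0 → Quota (suc l) N
  apex-free-wing 14+ 41+ 42≡0 = quota
    ((0F , 0F) ↦ suc l ∷ (2F , 2F) ↦ N 2F 2F ∷ (3F , 2F) ↦ N 3F 2F ∷ (4F , 1F) ↦ 1 ∷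
     (4F , 4F) ↦ l ∷ none)
    (core-core ∷≤ all-of 2F 2F (all-of 3F 2F (41+ ∷≤ <⇒≤ free-free ∷≤ none≤)))
    (trans (cong (λ x → suc l + 0 + (0 + x))
      (trans (sym (+-assoc (N 2F 2F + 0) (N 3F 2F + 0) _))
        (cong (_+ (1 + (l + 0) + 0)) (trans (pad (N 2F 2F) (N 3F 2F)) wings)))) total)
    (inj₂ ((core! , inj₁ (trans (pad (N 2F 2F) (N 3F 2F)) wings , refl)) ,
           (core! , inj₂ (inj₁ (cong suc (trans (+-identityʳ _) wings) , inj₂ refl)))))
    where
    wings : N 2F 2F + (N 3F 2F + 0) ≡ suc l
    wings = keep-middle (N 2F 2F) (N 3F 2F) col₂ (core-row 2F λ ()) (sum≡1⇒unique (N 1F) row₁ 14+ 2F λ ()) 42≡0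

    total : suc l + 0 + (0 + (suc l + (1 + (l + 0) + 0))) ≡ 3 * suc l
    total = solve (l ∷ [])

sum≡1⇒some : ∀ {n} (t : Fin n → ℕ) → sum t ≡ 1 → ∃[ i ] 1 ≤ t i
sum≡1⇒some {suc n} t eq with zero⊎positive (t zero)
... | inj₂ 1≤ = zero , 1≤
... | inj₁ t0 with i , 1≤ ← sum≡1⇒some (t ∘ suc) (trans (sym (cong (_+ sum (t ∘ suc)) t0)) eq) =
  suc i , 1≤

Diagonal : Table → Set
Diagonal N = ∀ i j → i ≢ j → N i j ≡ 0

module _ {l : ℕ} {N : Table} (o : Overlap (suc l) N) where

  open Overlap o

  private
    oᵀ : Overlap (suc l) (flip N)
    oᵀ = flip-overlap o

    Small : Set
    Small = suc l ≤ N 3F 4F × suc l ≤ N 4F 3F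

    big⊎small : suc l ≤ N 3F 3F ⊎ Small
    big⊎small with base-dichotomy o | base-dichotomy oᵀ
    ... | inj₁ big   | _          = inj₁ big
    ... | inj₂ _     | inj₁ big   = inj₁ big
    ... | inj₂ 34+   | inj₂ 43+   = inj₂ (34+ , 43+)

  separate-same-apex : 1 ≤ N 1F 1F → Quota (suc l) N ⊎ Diagonal N
  separate-same-apex 11+ with big⊎small
  ... | inj₂ (34+ , 43+) = inj₁ (same-apex-small o 11+ 34+ 43+)
  ... | inj₁ big
    with zero⊎positive (N 4F 2F) | zero⊎positive (N 4F 3F)
       | zero⊎positive (N 2F 4F) | zero⊎positive (N 3F 4F)
       | zero⊎positive (N 2F 3F) | zero⊎positive (N 3F 2F)
  ... | inj₂ 42+ | _ | _ | _ | _ | _ = inj₁ (same-apex-big o big (inj₁ 42+))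
  ... | _ | inj₂ 43+ | _ | _ | _ | _ = inj₁ (same-apex-big o big (inj₂ 43+))
  ... | _ | _ | inj₂ 24+ | _ | _ | _ = inj₁ (flip-quota (same-apex-big oᵀ big (inj₁ 24+)))
  ... | _ | _ | _ | inj₂ 34+ | _ | _ = inj₁ (flip-quota (same-apex-big oᵀ big (inj₂ 34+)))
  ... | _ | _ | inj₁ z24 | _ | inj₂ 23+ | _ = inj₁ (same-apex-wing o 11+ z24 23+)
  ... | inj₁ z42 | _ | _ | _ | _ | inj₂ 32+ = inj₁ (flip-quota (same-apex-wing oᵀ 11+ z42 32+))
  ... | inj₁ z42 | inj₁ z43 | inj₁ z24 | inj₁ z34 | inj₁ z23 | inj₁ z32 = inj₂ diagonal
    where
    diagonal : Diagonal N
    diagonal 0F j 0≢j = core-row j (0≢j ∘ sym)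
    diagonal i 0F i≢0 = core-col i i≢0
    diagonal 1F j 1≢j = sum≡1⇒unique (N 1F) row₁ 11+ j (1≢j ∘ sym)
    diagonal i 1F i≢1 = sum≡1⇒unique (flip N 1F) col₁ 11+ i i≢1
    diagonal 2F 3F _ = z23
    diagonal 2F 4F _ = z24
    diagonal 3F 2F _ = z32
    diagonal 3F 4F _ = z34
    diagonal 4F 2F _ = z42
    diagonal 4F 3F _ = z43
    diagonal 2F 2F i≢i = contradiction refl i≢i
    diagonal 3F 3F i≢i = contradiction refl i≢i
    diagonal 4F 4F i≢i = contradiction refl i≢i

  apex-covered : 1 ≤ N 1F 2F ⊎ 1 ≤ N 1F 3F → Quota (suc l) N
  apex-covered 1j+ with big⊎small
  ... | inj₁ big         = apex-covered-big o big 1j+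
  ... | inj₂ (34+ , 43+) = apex-covered-small o 34+ 43+ 1j+

  apexes-free : 1 ≤ N 1F 4F → 1 ≤ N 4F 1F → Quota (suc l) N
  apexes-free 14+ 41+ with big⊎small
  ... | inj₂ (34+ , 43+) = apex-free-small o 14+ 34+ 43+
  ... | inj₁ big with zero⊎positive (N 4F 2F)
  ...   | inj₁ z42 = apex-free-wing o 14+ 41+ z42
  ...   | inj₂ 42+ = apex-free-big o 14+ big (inj₁ 42+)

module _ {l : ℕ} {N : Table} (o : Overlap (suc l) N) where

  open Overlap o

  -- The case depends on the class of each apex in the other pattern. Different apexes always yield
  -- a separating edge; only a common apex leaves the possibility that all classes agree.
  separate : Quota (suc l) N ⊎ Diagonal N
  separate with sum≡1⇒some (N 1F) row₁ | sum≡1⇒some (flip N 1F) col₁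
  ... | 0F , 10+ | _ = contradiction (subst (1 ≤_) (core-col 1F λ ()) 10+) λ ()
  ... | 1F , 11+ | _ = separate-same-apex o 11+
  ... | 2F , 12+ | _ = inj₁ (apex-covered o (inj₁ 12+))
  ... | 3F , 13+ | _ = inj₁ (apex-covered o (inj₂ 13+))
  ... | 4F , _   | 0F , 01+ = contradiction (subst (1 ≤_) (core-row 1F λ ()) 01+) λ ()
  ... | 4F , _   | 1F , 11+ = separate-same-apex o 11+
  ... | 4F , _   | 2F , 21+ = inj₁ (flip-quota (apex-covered (flip-overlap o) (inj₁ 21+)))
  ... | 4F , _   | 3F , 31+ = inj₁ (flip-quota (apex-covered (flip-overlap o) (inj₂ 31+)))
  ... | 4F , 14+ | 4F , 41+ = inj₁ (apexes-free o 14+ 41+)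

-- Labellings of the vertices and the edges they prescribe

Role : Set
Role = Fin 6

pattern pole = 5F

coarse : Role → Fin 5
coarse 0F = 0F
coarse 1F = 1F
coarse 2F = 2F
coarse 3F = 3F
coarse 4F = 4F
coarse 5F = 4F

-- As vectors, labellings with equal entries are equal, and the existence of a fitting one is
-- decidable by search.
Labelling : ℕ → Set
Labelling = Vec Role

class : ∀ {n} → Labelling n → Fin n → Fin 5
class π v = coarse (lookup π v)

profile : ∀ {n} → Labelling n → Subset n → Profile
profile π S i = # (λ v → lookup S v ∧ (class π v == i))

poles : ∀ {n} → Labelling n → Subset n → ℕ
poles π S = # (λ v → lookup S v ∧ (lookup π v == 5F))

size : ∀ {n} → Labelling n → Profile
size π i = # (λ v → class π v == i)

record Present {n} (m : ℕ) (π : Labelling n) (S : Subset n) : Set where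
  constructor on⁺
  field
    polar    : 1 ≤ poles π S
    positive : Positive m (profile π S)

data Absent {n} (m : ℕ) (π : Labelling n) (S : Subset n) : Set where
  on⁻  : 1 ≤ poles π S → Negative m (profile π S) → Absent m π S
  off⁻ : poles π S ≡ 0 → profile π S 0F ≡ m → Mark m (profile π S) → Absent m π S

-- Enough for 2 m base vertices to avoid two given edges of size 3 m + 1.
bases : ℕ → ℕ
bases m = 2 * m + 2 * suc (3 * m)

placed : ℕ → ℕ
placed m = m + (1 + (m + bases m))

record Sized {n} (m : ℕ) (π : Labelling n) : Set where
  field
    core-size : size π 0F ≡ m
    apex-size : size π 1F ≡ 1
    wing-size : size π 2F ≡ m
    base-size : size π 3F ≡ bases m

-- Class 4F is exempt because inserting a pole into a set changes that count and no other.
Positive-resp : ∀ {m p p′} → (∀ i → i ≢ 4F → p i ≡ p′ i) → Positive m p → Positive m p′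
Positive-resp p≗ pos
  rewrite sym (p≗ 0F λ ()) | sym (p≗ 1F λ ()) | sym (p≗ 2F λ ()) | sym (p≗ 3F λ ()) = pos

Negative-resp : ∀ {m p p′} → (∀ i → i ≢ 4F → p i ≡ p′ i) → Negative m p → Negative m p′
Negative-resp p≗ neg
  rewrite sym (p≗ 0F λ ()) | sym (p≗ 1F λ ()) | sym (p≗ 2F λ ()) | sym (p≗ 3F λ ()) = neg

#-≤-outside : ∀ {n} (p q : Fin n → Bool) → # p ≤ # (λ v → p v ∧ not (q v)) + # q
#-≤-outside p q = begin
  # p                                                   ≡⟨ #-complement p q ⟩
  # (λ v → p v ∧ q v) + # (λ v → p v ∧ not (q v))
    ≤⟨ +-monoˡ-≤ _ (#-mono λ v → proj₂ ∘ ∧-true {p v}) ⟩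
  # q + # (λ v → p v ∧ not (q v))                       ≡⟨ +-comm (# q) _ ⟩
  # (λ v → p v ∧ not (q v)) + # q                       ∎
  where open ≤-Reasoning

module _ {n m : ℕ} {π : Labelling n} (sized : Sized m π) where

  open Sized sized

  size-sum : n ≡ placed m + size π 4F
  size-sum = begin
    n                                        ≡⟨ #-all n ⟨
    # {n} (const true)                       ≡⟨ #-split (const true) (class π) ⟩
    sum (size π)
      ≡⟨ cong₂ _+_ core-size (cong₂ _+_ apex-size (cong₂ _+_ wing-size
           (cong₂ _+_ base-size (+-identityʳ (size π 4F))))) ⟩
    m + (1 + (m + (bases m + size π 4F)))    ≡⟨ regroup m (bases m) (size π 4F) ⟩
    placed m + size π 4F                     ∎
    where
    open ≡-Reasoning
    regroup : ∀ a b c → a + (1 + (a + (b + c))) ≡ a + (1 + (a + b)) + c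
    regroup a b c = solve (a ∷ b ∷ c ∷ [])

  unfree : # (λ v → not (class π v == 4F)) ≡ placed m
  unfree = +-cancelˡ-≡ (size π 4F) _ _ (begin
    size π 4F + # (λ v → not (class π v == 4F)) ≡⟨ #-complement (const true) (λ v → class π v == 4F) ⟨
    # {n} (const true)                          ≡⟨ #-all n ⟩
    n                                           ≡⟨ size-sum ⟩
    placed m + size π 4F                        ≡⟨ +-comm (placed m) _ ⟩
    size π 4F + placed m                        ∎)
    where open ≡-Reasoning

-- Union bound. With p and q the class 4F of two patterns and r their common pole, it leaves m
-- further vertices of class 4F in both once n is large.
common-≥ : ∀ {n} (p q r : Fin n → Bool) →
           n ≤ # (not ∘ p) + (# (not ∘ q) + (# r + # (λ v → not (r v) ∧ (p v ∧ q v))))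
common-≥ {n} p q r = begin
  n
    ≡⟨ #-all n ⟨
  # {n} (const true)
    ≡⟨ #-complement (const true) (not ∘ p) ⟩
  # (not ∘ p) + # (λ v → not (not (p v)))
    ≤⟨ +-monoʳ-≤ (# (not ∘ p)) (#-≤-outside (λ v → not (not (p v))) (not ∘ q)) ⟩
  # (not ∘ p) + (# (λ v → not (not (p v)) ∧ not (not (q v))) + # (not ∘ q))
    ≤⟨ +-monoʳ-≤ (# (not ∘ p)) (+-monoˡ-≤ (# (not ∘ q)) (#-≤-outside (λ v → not (not (p v)) ∧ not (not (q v))) r)) ⟩
  # (not ∘ p) + (# (λ v → (not (not (p v)) ∧ not (not (q v))) ∧ not (r v)) + # r + # (not ∘ q))
    ≡⟨ cong (# (not ∘ p) +_) (trans (+-comm _ (# (not ∘ q))) (cong (# (not ∘ q) +_)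
         (trans (+-comm _ (# r)) (cong (# r +_) (#-cong λ v → tidy (p v) (q v) (r v)))))) ⟩
  # (not ∘ p) + (# (not ∘ q) + (# r + # (λ v → not (r v) ∧ (p v ∧ q v)))) ∎
  where
  open ≤-Reasoning
  tidy : ∀ x y z → (not (not x) ∧ not (not y)) ∧ not z ≡ not z ∧ (x ∧ y)
  tidy x y z rewrite not-involutive x | not-involutive y = ∧-comm (x ∧ y) (not z)

leftover : ∀ {n m x} a → 2 * a + (1 + m) ≤ n → n ≤ a + (a + (1 + x)) → m ≤ x
leftover {n} {m} {x} a room n≤ = +-cancelˡ-≤ (2 * a + 1) m x (begin
  2 * a + 1 + m       ≡⟨ +-assoc (2 * a) 1 m ⟩
  2 * a + (1 + m)     ≤⟨ room ⟩
  n                   ≤⟨ n≤ ⟩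
  a + (a + (1 + x))   ≡⟨ regroup a x ⟩
  2 * a + 1 + x       ∎)
  where
  open ≤-Reasoning
  regroup : ∀ a x → a + (a + (1 + x)) ≡ 2 * a + 1 + x
  regroup a x = solve (a ∷ x ∷ [])

#-single : ∀ {n} (b : Fin n) → # (λ v → b == v) ≡ 1
#-single b = sum-== b

class-pole : ∀ {n} (π : Labelling n) {b} → lookup π b ≡ pole → class π b ≡ 4F
class-pole _ = cong coarse

==-false : ∀ {r} {i j : Fin r} → i ≢ j → (i == j) ≡ false
==-false {i = i} {j} = dec-false (i ≟ j)

∣insert∣ : ∀ {n} (S : Subset n) {v} → lookup S v ≡ false → ∣ S [ v ]≔ true ∣ ≡ suc (# (lookup S))
∣insert∣ S {v} v∉S = begin
  ∣ S⁺ ∣                                   ≡⟨ ∣∣≡# S⁺ ⟩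
  # (lookup S⁺)                            ≡⟨ #-cong (λ u → ∧-identityʳ (lookup S⁺ u)) ⟨
  # (λ u → lookup S⁺ u ∧ true)             ≡⟨ #-insert S (const true) v v∉S ⟩
  suc (# (λ u → lookup S u ∧ true))        ≡⟨ cong suc (#-cong λ u → ∧-identityʳ (lookup S u)) ⟩
  suc (# (lookup S))                       ∎
  where
  open ≡-Reasoning
  S⁺ = S [ v ]≔ true

profile-insert : ∀ {n} (π : Labelling n) (S : Subset n) {v} → lookup S v ≡ false → class π v ≡ 4F →
                 ∀ {i} → i ≢ 4F → profile π (S [ v ]≔ true) i ≡ profile π S i
profile-insert π S {v} v∉S πv {i} i≢4 = trans
  (#-insert S (λ u → class π u == i) v v∉S)
  (cong (λ x → bit x + profile π S i) (==-false λ eq → i≢4 (trans (sym eq) πv)))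

_≟²_ : DecidableEquality (Fin 5 × Fin 5)
(i , j) ≟² (i′ , j′) = map′ (uncurry (cong₂ _,_)) ,-injective (i ≟ i′ ×-dec j ≟ j′)

-- Two patterns with equal cores and a common pole: an edge of disagreement

module Meeting {n l : ℕ} {π π′ : Labelling n}
  (sized : Sized (suc l) π) (sized′ : Sized (suc l) π′)
  (same-core : ∀ v → (class π v == 0F) ≡ (class π′ v == 0F))
  {b : Fin n} (πb : lookup π b ≡ pole) (π′b : lookup π′ b ≡ pole)
  (room : 2 * placed (suc l) + (1 + suc l) ≤ n)
  where

  private
    m = suc l

  other : Fin n → Bool
  other v = not (b == v)

  meet : Fin n → Fin 5 × Fin 5
  meet v = class π v , class π′ v


  table : Table
  table i j = # (λ v → other v ∧ does (meet v ≟² (i , j)))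

  private
    split-row : ∀ (p : Fin n → Bool) i →
      # (λ v → p v ∧ (class π v == i)) ≡ sum (λ j → # (λ v → p v ∧ does (meet v ≟² (i , j))))
    split-row p i = trans (#-split (λ v → p v ∧ (class π v == i)) (class π′))
      (sum-cong-≗ λ j → #-cong λ v → ∧-assoc (p v) (class π v == i) (class π′ v == j))

    split-col : ∀ (p : Fin n → Bool) j →
      # (λ v → p v ∧ (class π′ v == j)) ≡ sum (λ i → # (λ v → p v ∧ does (meet v ≟² (i , j))))
    split-col p j = trans (#-split (λ v → p v ∧ (class π′ v == j)) (class π))
      (sum-cong-≗ λ i → #-cong λ v → trans (∧-assoc (p v) (class π′ v == j) (class π v == i))
        (cong (p v ∧_) (∧-comm (class π′ v == j) (class π v == i))))

    other-vacuous : ∀ {ρ : Labelling n} → class ρ b ≡ 4F → ∀ i → i ≢ 4F →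
                    ∀ v → other v ∧ (class ρ v == i) ≡ (class ρ v == i)
    other-vacuous ρb i i≢4 v with b ≟ v
    ... | no  _    = refl
    ... | yes refl = sym (==-false (λ eq → i≢4 (trans (sym eq) ρb)))

    row-size : ∀ i → i ≢ 4F → rows table i ≡ size π i
    row-size i i≢4 = trans (sym (split-row other i))
      (#-cong (other-vacuous {π} (class-pole π πb) i i≢4))

    col-size : ∀ j → j ≢ 4F → cols table j ≡ size π′ j
    col-size j j≢4 = trans (sym (split-col other j))
      (#-cong (other-vacuous {π′} (class-pole π′ π′b) j j≢4))

    core-row′ : ∀ j → j ≢ 0F → table 0F j ≡ 0
    core-row′ j j≢0 = #-none λ v → trans (cong (other v ∧_) (none-at v)) (∧-zeroʳ _)
      where
      none-at : ∀ v → (class π v == 0F) ∧ (class π′ v == j) ≡ false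
      none-at v rewrite same-core v with class π′ v ≟ 0F
      ... | no  _  = refl
      ... | yes eq = ==-false λ eq′ → j≢0 (trans (sym eq′) eq)

    core-col′ : ∀ i → i ≢ 0F → table i 0F ≡ 0
    core-col′ i i≢0 = #-none λ v → trans (cong (other v ∧_) (none-at v)) (∧-zeroʳ _)
      where
      none-at : ∀ v → (class π v == i) ∧ (class π′ v == 0F) ≡ false
      none-at v rewrite sym (same-core v) with class π v ≟ 0F
      ... | no  _  = ∧-zeroʳ _
      ... | yes eq = cong (_∧ true) (==-false λ eq′ → i≢0 (trans (sym eq′) eq))

    core-core′ : m ≤ table 0F 0F
    core-core′ = ≤-reflexive (begin
      m                                                         ≡⟨ Sized.core-size sized ⟨
      size π 0F                                                 ≡⟨ row-size 0F (λ ()) ⟨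
      table 0F 0F + (table 0F 1F + (table 0F 2F + (table 0F 3F + (table 0F 4F + 0))))
        ≡⟨ cong (table 0F 0F +_) (cong₂ _+_ (core-row′ 1F λ ()) (cong₂ _+_ (core-row′ 2F λ ())
             (cong₂ _+_ (core-row′ 3F λ ()) (cong (_+ 0) (core-row′ 4F λ ()))))) ⟩
      table 0F 0F + 0                                           ≡⟨ +-identityʳ _ ⟩
      table 0F 0F                                               ∎)
      where open ≡-Reasoning

    free-free′ : m ≤ table 4F 4F
    free-free′ = leftover (placed m) room (subst (n ≤_)
      (cong₂ _+_ (unfree sized) (cong₂ _+_ (unfree sized′)
        (cong (_+ table 4F 4F) (#-single b))))
      (common-≥ (λ v → class π v == 4F) (λ v → class π′ v == 4F) (b ==_)))

    3*m<bases : 3 * m < bases m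
    3*m<bases = ≤-trans (m≤m+n (suc (3 * m)) _) (m≤n+m (2 * suc (3 * m)) (2 * m))

    meetings : Overlap m table
    meetings = record
      { core-core = core-core′ ; free-free = free-free′
      ; core-row = core-row′ ; core-col = core-col′
      ; row₁ = trans (row-size 1F λ ()) (Sized.apex-size sized)
      ; col₁ = trans (col-size 1F λ ()) (Sized.apex-size sized′)
      ; row₂ = trans (row-size 2F λ ()) (Sized.wing-size sized)
      ; col₂ = trans (col-size 2F λ ()) (Sized.wing-size sized′)
      ; row₃ = subst (3 * m <_) (sym (trans (row-size 3F λ ()) (Sized.base-size sized))) 3*m<bases
      ; col₃ = subst (3 * m <_) (sym (trans (col-size 3F λ ()) (Sized.base-size sized′))) 3*m<bases
      }

  Conflict : Set
  Conflict = ∃[ S ] ∣ S ∣ ≡ suc (3 * m) × lookup S b ≡ true ×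
    ((Present m π S × Absent m π′ S) ⊎ (Absent m π S × Present m π′ S))

  private
    -- The quotas supply 3 m vertices and b completes the edge. As b is a pole of both patterns, it
    -- makes the edge polar for both and leaves the counts on which `Separating` depends unchanged.
    realise : Quota m table → Conflict
    realise (quota t fits total separating) =
      S , ∣S∣ , b∈S , conflict separating
      where
      selection = select _≟²_ other meet (λ (i , j) → t i j) (λ (i , j) → fits i j)
      S₀ = proj₁ selection

      chosen : ∀ i j → # (λ v → lookup S₀ v ∧ does (meet v ≟² (i , j))) ≡ t i j
      chosen i j = proj₂ (proj₂ selection) (i , j)

      b∉S₀ : lookup S₀ b ≡ false
      b∉S₀ with lookup S₀ b in eq
      ... | false = refl
      ... | true  = contradiction (trans (sym (cong not (==-refl b))) (proj₁ (proj₂ selection) b eq)) λ ()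

      S = S₀ [ b ]≔ true

      b∈S : lookup S b ≡ true
      b∈S = lookup∘updateAt b S₀

      row₀ : ∀ i → profile π S₀ i ≡ rows t i
      row₀ i = trans (split-row (lookup S₀) i) (sum-cong-≗ (chosen i))

      col₀ : ∀ j → profile π′ S₀ j ≡ cols t j
      col₀ j = trans (split-col (lookup S₀) j) (sum-cong-≗ (λ i → chosen i j))

      ∣S∣ : ∣ S ∣ ≡ suc (3 * m)
      ∣S∣ = begin
        ∣ S ∣                                    ≡⟨ ∣insert∣ S₀ b∉S₀ ⟩
        suc (# (lookup S₀))                      ≡⟨ cong suc (#-split (lookup S₀) (class π)) ⟩
        suc (sum (profile π S₀))                 ≡⟨ cong suc (sum-cong-≗ row₀) ⟩
        suc (sum (rows t))                       ≡⟨ cong suc total ⟩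
        suc (3 * m)                              ∎
        where open ≡-Reasoning

      rows≗ : ∀ i → i ≢ 4F → rows t i ≡ profile π S i
      rows≗ i i≢4 = sym (trans (profile-insert π S₀ b∉S₀ (class-pole π πb) i≢4) (row₀ i))

      cols≗ : ∀ j → j ≢ 4F → cols t j ≡ profile π′ S j
      cols≗ j j≢4 = sym (trans (profile-insert π′ S₀ b∉S₀ (class-pole π′ π′b) j≢4) (col₀ j))

      polar : ∀ {ρ : Labelling n} → lookup ρ b ≡ pole → 1 ≤ poles ρ S
      polar ρb = #-positive {v = b} (cong₂ _∧_ b∈S (cong (_== pole) ρb))

      conflict : Separating m t → (Present m π S × Absent m π′ S) ⊎ (Absent m π S × Present m π′ S)
      conflict (inj₁ (pos , neg)) = inj₁
        (on⁺ (polar {π} πb) (Positive-resp rows≗ pos) , on⁻ (polar {π′} π′b) (Negative-resp cols≗ neg))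
      conflict (inj₂ (neg , pos)) = inj₂
        (on⁻ (polar {π} πb) (Negative-resp rows≗ neg) , on⁺ (polar {π′} π′b) (Positive-resp cols≗ pos))

    aligned : Diagonal table → ∀ v → class π v ≡ class π′ v
    aligned diagonal v with b ≟ v
    ... | yes refl = trans (class-pole π πb) (sym (class-pole π′ π′b))
    ... | no b≢v with class π v ≟ class π′ v
    ...   | yes eq = eq
    ...   | no neq = contradiction (#-positive {v = v} v-counted) (<⇒≱ (s≤s (≤-reflexive (diagonal _ _ neq))))
      where
      v-counted : other v ∧ does (meet v ≟² (class π v , class π′ v)) ≡ true
      v-counted = cong₂ _∧_ (cong not (==-false b≢v)) (dec-true (meet v ≟² meet v) refl)

  conflict⊎aligned : Conflict ⊎ (∀ v → class π v ≡ class π′ v)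
  conflict⊎aligned with separate meetings
  ... | inj₁ q        = inj₁ (realise q)
  ... | inj₂ diagonal = inj₂ (aligned diagonal)

-- Marks through a given vertex, different from two given sets

markQuota : ℕ → Profile
markQuota m 0F = m
markQuota m 3F = 2 * m
markQuota m _  = 0

module Marking {n l : ℕ} {π : Labelling n} (sized : Sized (suc l) π)
  {v : Fin n} (πv : class π v ≡ 4F) (S S′ : Subset n)
  (∣S∣ : ∣ S ∣ ≤ suc (3 * suc l)) (∣S′∣ : ∣ S′ ∣ ≤ suc (3 * suc l))
  where

  private
    m = suc l

    avoiding : Fin n → Bool
    -- Only base vertices have to avoid S and S′. Core vertices are exempt, since a mark contains
    -- the entire core.
    avoiding u = (class π u == 0F) ∨ (not (lookup S u) ∧ not (lookup S′ u))

    fits : ∀ i → markQuota m i ≤ # (λ u → avoiding u ∧ (class π u == i))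
    fits 0F = ≤-trans (≤-reflexive (sym (Sized.core-size sized)))
      (#-mono λ u u-core → cong₂ _∧_ (cong (_∨ (not (lookup S u) ∧ not (lookup S′ u))) u-core) u-core)
    fits 1F = z≤n
    fits 2F = z≤n
    fits 3F = +-cancelʳ-≤ (2 * suc (3 * m)) _ _ (begin
      bases m                                     ≡⟨ Sized.base-size sized ⟨
      # base                                      ≤⟨ #-≤-outside base (lookup S) ⟩
      # (λ u → base u ∧ not (lookup S u)) + # (lookup S)
        ≤⟨ +-monoˡ-≤ (# (lookup S)) (#-≤-outside (λ u → base u ∧ not (lookup S u)) (lookup S′)) ⟩
      # (λ u → (base u ∧ not (lookup S u)) ∧ not (lookup S′ u)) + # (lookup S′) + # (lookup S)
        ≤⟨ +-mono-≤ (+-mono-≤ (#-mono avoids) (subst (_≤ suc (3 * m)) (∣∣≡# S′) ∣S′∣))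
             (subst (_≤ suc (3 * m)) (∣∣≡# S) ∣S∣) ⟩
      # (λ u → avoiding u ∧ base u) + suc (3 * m) + suc (3 * m)
        ≡⟨ regroup (# (λ u → avoiding u ∧ base u)) (suc (3 * m)) ⟩
      # (λ u → avoiding u ∧ base u) + 2 * suc (3 * m) ∎)
      where
      open ≤-Reasoning
      base : Fin n → Bool
      base u = class π u == 3F

      regroup : ∀ x y → x + y + y ≡ x + 2 * y
      regroup x y = solve (x ∷ y ∷ [])

      rearrange : ∀ x y z w → (y ∧ z) ∧ w ≡ true → (x ∨ (z ∧ w)) ∧ y ≡ true
      rearrange false true true true _ = refl
      rearrange true  true true true _ = refl

      avoids : ∀ u → (base u ∧ not (lookup S u)) ∧ not (lookup S′ u) ≡ true →
               avoiding u ∧ base u ≡ true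
      avoids u = rearrange (class π u == 0F) (base u) (not (lookup S u)) (not (lookup S′ u))
    fits 4F = z≤n

    selection = select _≟_ avoiding (class π) (markQuota m) fits
    T₀ = proj₁ selection

    chosen : ∀ i → profile π T₀ i ≡ markQuota m i
    chosen = proj₂ (proj₂ selection)

    T₀-placed : ∀ u → lookup T₀ u ≡ true → class π u ≢ 4F
    T₀-placed u u∈T₀ πu = contradiction
      (#-positive {v = u} (cong₂ _∧_ u∈T₀ (dec-true (class π u ≟ 4F) πu)))
      (<⇒≱ (s≤s (≤-reflexive (chosen 4F))))

    v∉T₀ : lookup T₀ v ≡ false
    v∉T₀ with lookup T₀ v in eq
    ... | false = refl
    ... | true  = contradiction πv (T₀-placed v eq)

  T : Subset n
  T = T₀ [ v ]≔ true

  ∣T∣ : ∣ T ∣ ≡ suc (3 * m)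
  ∣T∣ = begin
    ∣ T ∣                       ≡⟨ ∣insert∣ T₀ v∉T₀ ⟩
    suc (# (lookup T₀))         ≡⟨ cong suc (#-split (lookup T₀) (class π)) ⟩
    suc (sum (profile π T₀))    ≡⟨ cong suc (sum-cong-≗ chosen) ⟩
    suc (m + (2 * m + 0))       ≡⟨ cong (λ x → suc (m + x)) (+-identityʳ (2 * m)) ⟩
    suc (3 * m)                 ∎
    where open ≡-Reasoning

  v∈T : lookup T v ≡ true
  v∈T = lookup∘updateAt v T₀

  free-only-v : ∀ u → lookup T u ≡ true → class π u ≡ 4F → u ≡ v
  free-only-v u u∈T πu with u ≟ v
  ... | yes u≡v = u≡v
  ... | no  u≢v = contradiction πu
    (T₀-placed u (trans (sym (lookup∘updateAt′ u v u≢v T₀)) u∈T))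

  profile-T : ∀ i → i ≢ 4F → profile π T i ≡ markQuota m i
  profile-T i i≢4 = trans (profile-insert π T₀ v∉T₀ πv i≢4) (chosen i)

  private
    -- As 2 m is positive, the mark has a base vertex. It lies outside S and S′, so T is neither of
    -- them.
    witness : ∃[ u ] lookup T₀ u ∧ (class π u == 3F) ≡ true
    witness = #-witness (subst (1 ≤_) (sym (chosen 3F)) (s≤s z≤n))

    u  = proj₁ witness
    u∈T₀ = proj₁ (∧-true {lookup T₀ u} (proj₂ witness))
    πu = proj₂ (∧-true {lookup T₀ u} (proj₂ witness))

    u∈T : lookup T u ≡ true
    u∈T with u ≟ v
    ... | yes u≡v = subst (λ w → lookup T w ≡ true) (sym u≡v) v∈T
    ... | no  u≢v = trans (lookup∘updateAt′ u v u≢v T₀) u∈T₀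

    u-avoids : not (lookup S u) ∧ not (lookup S′ u) ≡ true
    u-avoids = subst (λ b → b ∨ (not (lookup S u) ∧ not (lookup S′ u)) ≡ true)
      (cong (_== 0F) (==-sound {i = class π u} {3F} πu)) (proj₁ (proj₂ selection) u u∈T₀)

    u∉ : ∀ {R} → not (lookup R u) ≡ true → T ≢ R
    u∉ u∉R refl = contradiction (trans (sym u∉R) (cong not u∈T)) λ ()

  T≢S : T ≢ S
  T≢S = u∉ (proj₁ (∧-true u-avoids))

  T≢S′ : T ≢ S′
  T≢S′ = u∉ (proj₂ (∧-true {not (lookup S u)} u-avoids))

  mark : Mark m (profile π T)
  mark = profile-T 3F (λ ()) , cong₂ _+_ (profile-T 1F λ ()) (profile-T 2F λ ())

-- The property

edge : ∀ n k → Fin (n C k) → Subset n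
edge n k i = proj₁ (subsetAt {n} {k} i)

∣edge∣ : ∀ n k (i : Fin (n C k)) → ∣ edge n k i ∣ ≡ k
∣edge∣ n k i = proj₂ (subsetAt {n} {k} i)

edge-indexOf : ∀ n k (S : KSubset n k) → edge n k (indexOf S) ≡ proj₁ S
edge-indexOf n k S = cong proj₁ (Inverse.strictlyInverseˡ (indexing n k) S)

edge-injective : ∀ n k {i j : Fin (n C k)} → edge n k i ≡ edge n k j → i ≡ j
edge-injective n k {i} {j} eq = begin
  i                                     ≡⟨ Inverse.strictlyInverseʳ (indexing n k) i ⟨
  indexOf {n} {k} (subsetAt {n} {k} i)  ≡⟨ cong (indexOf {n} {k}) (KSubset-≡ eq) ⟩
  indexOf {n} {k} (subsetAt {n} {k} j)  ≡⟨ Inverse.strictlyInverseʳ (indexing n k) j ⟩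
  j                                     ∎
  where open ≡-Reasoning

Mark? : ∀ m p → Dec (Mark m p)
Mark? m p = p 3F ℕ.≟ 2 * m ×-dec p 1F + p 2F ℕ.≟ 0

Positive? : ∀ m p → Dec (Positive m p)
Positive? m p = p 0F ℕ.≟ m ×-dec
  ((body p ℕ.≟ m ×-dec p 1F ℕ.≟ 1) ⊎-dec
   (body p ℕ.≟ suc m ×-dec (p 1F ℕ.≟ 0 ⊎-dec p 3F ℕ.≟ 0)) ⊎-dec Mark? m p)

Negative? : ∀ m p → Dec (Negative m p)
Negative? m p = p 0F ℕ.≟ m ×-dec
  ((body p ℕ.≟ m ×-dec p 1F ℕ.≟ 0) ⊎-dec (body p ℕ.≟ suc m ×-dec p 1F ℕ.≟ 1 ×-dec 1 ≤? p 3F))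

Present? : ∀ {n} m (π : Labelling n) S → Dec (Present m π S)
Present? m π S = map′ (uncurry on⁺) (λ (on⁺ 1≤ pos) → 1≤ , pos)
  (1 ≤? poles π S ×-dec Positive? m (profile π S))

Absent? : ∀ {n} m (π : Labelling n) S → Dec (Absent m π S)
Absent? m π S = map′
  (λ { (inj₁ (1≤ , neg)) → on⁻ 1≤ neg ; (inj₂ (≡0 , ≡m , mark)) → off⁻ ≡0 ≡m mark })
  (λ { (on⁻ 1≤ neg) → inj₁ (1≤ , neg) ; (off⁻ ≡0 ≡m mark) → inj₂ (≡0 , ≡m , mark) })
  ((1 ≤? poles π S ×-dec Negative? m (profile π S)) ⊎-dec
   (poles π S ℕ.≟ 0 ×-dec profile π S 0F ℕ.≟ m ×-dec Mark? m (profile π S)))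

Sized? : ∀ {n} m (π : Labelling n) → Dec (Sized m π)
Sized? m π = map′
  (λ (a , b , c , d) → record { core-size = a ; apex-size = b ; wing-size = c ; base-size = d })
  (λ s → Sized.core-size s , Sized.apex-size s , Sized.wing-size s , Sized.base-size s)
  (size π 0F ℕ.≟ m ×-dec size π 1F ℕ.≟ 1 ×-dec size π 2F ℕ.≟ m ×-dec size π 3F ℕ.≟ bases m)

-- Consistency of the prescriptions, which makes patterns realisable. The delicate case is a mark:
-- its body size 2 m exceeds m because m is positive, and when it equals m + 1 the missing apex
-- still keeps it from being negative.
¬Positive×Negative : ∀ {l} (p : Profile) → Positive (suc l) p → ¬ Negative (suc l) p
¬Positive×Negative p (_ , inj₁ (_ , a)) (_ , inj₁ (_ , a′)) = contradiction (trans (sym a) a′) λ ()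
¬Positive×Negative p (_ , inj₁ (b , _)) (_ , inj₂ (b′ , _)) = 1+n≢n (trans (sym b′) b)
¬Positive×Negative p (_ , inj₂ (inj₁ (b , _))) (_ , inj₁ (b′ , _)) = 1+n≢n (trans (sym b) b′)
¬Positive×Negative p (_ , inj₂ (inj₁ (_ , inj₁ a))) (_ , inj₂ (_ , a′ , _)) =
  contradiction (trans (sym a) a′) λ ()
¬Positive×Negative p (_ , inj₂ (inj₁ (_ , inj₂ a))) (_ , inj₂ (_ , _ , a′)) =
  contradiction (subst (1 ≤_) a a′) λ ()
¬Positive×Negative {l} p (_ , inj₂ (inj₂ (a , z))) (_ , inj₁ (b , _)) =
  m+1+n≢m l (sym (ℕ.suc-injective (begin
    suc l                     ≡⟨ b ⟨
    p 1F + (p 2F + p 3F)      ≡⟨ +-assoc (p 1F) (p 2F) (p 3F) ⟨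
    p 1F + p 2F + p 3F        ≡⟨ cong₂ _+_ z a ⟩
    2 * suc l                 ≡⟨ cong (λ x → suc (l + suc x)) (+-identityʳ l) ⟩
    suc (l + suc l)           ∎)))
  where open ≡-Reasoning
¬Positive×Negative p (_ , inj₂ (inj₂ (a , z))) (_ , inj₂ (_ , b , _)) =
  contradiction (trans (sym (m+n≡0⇒m≡0 (p 1F) z)) b) λ ()

¬Present×Absent : ∀ {n l} {π : Labelling n} {S} → Present (suc l) π S → ¬ Absent (suc l) π S
¬Present×Absent {π = π} {S} (on⁺ _ pos) (on⁻ _ neg) = ¬Positive×Negative (profile π S) pos neg
¬Present×Absent (on⁺ 1≤ _) (off⁻ ≡0 _ _) = contradiction (subst (1 ≤_) ≡0 1≤) λ ()

poleCount : ∀ {n} → Labelling n → ℕ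
poleCount π = # (λ v → lookup π v == pole)

record Fits {n} (m s : ℕ) {k} (x : Vec Bool (n C k)) (π : Labelling n) : Set where
  constructor fitting
  field
    sized         : Sized m π
    pole-count    : poleCount π ≡ s
    when-present  : ∀ i → Present m π (edge n k i) → lookup x i ≡ true
    when-absent   : ∀ i → Absent m π (edge n k i) → lookup x i ≡ false

anyLabelling? : ∀ {n} {P : Labelling n → Set} → (∀ π → Dec (P π)) → Dec (∃ P)
anyLabelling? {zero}  P? = map′ (λ p → Vec.[] , p) (λ { (Vec.[] , p) → p }) (P? Vec.[])
anyLabelling? {suc n} P? = map′ (λ (r , π , p) → r Vec.∷ π , p) (λ { (r Vec.∷ π , p) → r , π , p })
  (any? λ r → anyLabelling? λ π → P? (r Vec.∷ π))

module Property (n k m s : ℕ) where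

  FitsAt : Vec Bool (n C k) → Labelling n → Set
  FitsAt x π = Fits m s {k} x π

  FitsAt? : ∀ x π → Dec (FitsAt x π)
  FitsAt? x π = map′ (λ (a , b , c , d) → fitting a b c d) (λ (fitting a b c d) → a , b , c , d)
    (Sized? m π ×-dec poleCount π ℕ.≟ s ×-dec
     all? (λ i → Present? m π (edge n k i) →-dec lookup x i Bool.≟ true) ×-dec
     all? (λ i → Absent? m π (edge n k i) →-dec lookup x i Bool.≟ false))

  property : BooleanFunction (n C k)
  property x = does (anyLabelling? (FitsAt? x))

  sound : ∀ {x} → property x ≡ true → ∃ (FitsAt x)
  sound {x} = does-true (anyLabelling? (FitsAt? x))

  complete : ∀ {x π} → FitsAt x π → property x ≡ true
  complete {x} fits = dec-true (anyLabelling? (FitsAt? x)) (_ , fits)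

  refute : ∀ {x} → property x ≡ false → ∀ {π} → ¬ FitsAt x π
  refute eq fits = true≢false (complete fits) eq

-- Invariance under permutations of the vertices

relabel : ∀ {n} → Permutation′ n → Labelling n → Labelling n
relabel σ π = tabulate (λ v → lookup π (σ ⟨$⟩ʳ v))

module _ {n : ℕ} (σ : Permutation′ n) (π : Labelling n) where

  #-relabel : ∀ (S : Subset n) (ψ : Role → Bool) →
              # (λ v → lookup S v ∧ ψ (lookup (relabel σ π) v)) ≡
              # (λ v → lookup (image σ S) v ∧ ψ (lookup π v))
  #-relabel S ψ = sym (trans
    (sym (#-permute (λ v → lookup (image σ S) v ∧ ψ (lookup π v)) σ))
    (#-cong λ v → cong₂ (λ a r → a ∧ ψ r)
      (trans (lookup∘tabulate _ (σ ⟨$⟩ʳ v)) (cong (lookup S) (inverseˡ σ)))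
      (sym (lookup∘tabulate (λ u → lookup π (σ ⟨$⟩ʳ u)) v))))

  #-relabel-all : ∀ (ψ : Role → Bool) →
                  # (λ v → ψ (lookup (relabel σ π) v)) ≡ # (λ v → ψ (lookup π v))
  #-relabel-all ψ = trans
    (#-cong λ v → cong ψ (lookup∘tabulate (λ u → lookup π (σ ⟨$⟩ʳ u)) v))
    (#-permute (λ v → ψ (lookup π v)) σ)

  relabel-profile : ∀ S i → profile (relabel σ π) S i ≡ profile π (image σ S) i
  relabel-profile S i = #-relabel S (λ r → coarse r == i)

  relabel-poles : ∀ S → poles (relabel σ π) S ≡ poles π (image σ S)
  relabel-poles S = #-relabel S (_== pole)

  relabel-sized : ∀ {m} → Sized m π → Sized m (relabel σ π)
  relabel-sized sized = record
    { core-size = trans (#-relabel-all λ r → coarse r == 0F) core-size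
    ; apex-size = trans (#-relabel-all λ r → coarse r == 1F) apex-size
    ; wing-size = trans (#-relabel-all λ r → coarse r == 2F) wing-size
    ; base-size = trans (#-relabel-all λ r → coarse r == 3F) base-size }
    where open Sized sized

  relabel-present : ∀ {m S} → Present m (relabel σ π) S → Present m π (image σ S)
  relabel-present {S = S} (on⁺ 1≤ pos) =
    on⁺ (subst (1 ≤_) (relabel-poles S) 1≤) (Positive-resp (λ i _ → relabel-profile S i) pos)

  relabel-absent : ∀ {m S} → Absent m (relabel σ π) S → Absent m π (image σ S)
  relabel-absent {S = S} (on⁻ 1≤ neg) =
    on⁻ (subst (1 ≤_) (relabel-poles S) 1≤) (Negative-resp (λ i _ → relabel-profile S i) neg)
  relabel-absent {S = S} (off⁻ ≡0 core≡m (≡2m , none≡)) = off⁻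
    (trans (sym (relabel-poles S)) ≡0) (trans (sym (relabel-profile S 0F)) core≡m)
    (trans (sym (relabel-profile S 3F)) ≡2m ,
     trans (sym (cong₂ _+_ (relabel-profile S 1F) (relabel-profile S 2F))) none≡)

  -- At S the permuted input has the value of x at σ(S), and the relabelled pattern prescribes at S
  -- what π prescribes at σ(S).
  relabel-fits : ∀ {k m s x} → Fits m s {k} x π → Fits m s {k} (permute {n} {k} σ x) (relabel σ π)
  relabel-fits {k} {m} {s} {x} (fitting sized pole-count when-present when-absent) = fitting
    (relabel-sized sized) (trans (#-relabel-all (_== pole)) pole-count)
    (λ i present → trans (lookup∘tabulate (lookup x ∘ moved) i) (when-present (moved i)
      (subst (Present m π) (sym (edge-moved i)) (relabel-present present))))
    (λ i absent → trans (lookup∘tabulate (lookup x ∘ moved) i) (when-absent (moved i)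
      (subst (Absent m π) (sym (edge-moved i)) (relabel-absent absent))))
    where
    moved : Fin (n C k) → Fin (n C k)
    moved i = indexOf {n} {k} (imageₖ σ (subsetAt {n} {k} i))

    edge-moved : ∀ i → edge n k (moved i) ≡ image σ (edge n k i)
    edge-moved i = edge-indexOf n k (imageₖ σ (subsetAt {n} {k} i))

image-inverse : ∀ {n} (σ : Permutation′ n) (S : Subset n) → image σ (image (Perm.flip σ) S) ≡ S
image-inverse σ S = trans (tabulate-cong λ v → trans
  (lookup∘tabulate _ (σ ⟨$⟩ˡ v)) (cong (lookup S) (inverseʳ σ))) (tabulate∘lookup S)

permute-inverse : ∀ n k (σ : Permutation′ n) (x : Vec Bool (n C k)) →
                  permute {n} {k} (Perm.flip σ) (permute {n} {k} σ x) ≡ x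
permute-inverse n k σ x = begin
  tabulate (λ i → lookup (permute {n} {k} σ x) (at i))
    ≡⟨ tabulate-cong (λ i → lookup∘tabulate _ (at i)) ⟩
  tabulate (λ i → lookup x (indexOf {n} {k} (imageₖ σ (subsetAt {n} {k} (at i)))))
    ≡⟨ tabulate-cong (λ i → cong (lookup x) (back i)) ⟩
  tabulate (lookup x)
    ≡⟨ tabulate∘lookup x ⟩
  x ∎
  where
  open ≡-Reasoning
  at : Fin (n C k) → Fin (n C k)
  at i = indexOf {n} {k} (imageₖ (Perm.flip σ) (subsetAt {n} {k} i))

  back : ∀ i → indexOf {n} {k} (imageₖ σ (subsetAt {n} {k} (at i))) ≡ i
  back i = trans
    (cong (indexOf {n} {k}) (KSubset-≡ (trans
      (cong (image σ) (edge-indexOf n k (imageₖ (Perm.flip σ) (subsetAt {n} {k} i))))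
      (image-inverse σ (edge n k i)))))
    (Inverse.strictlyInverseʳ (indexing n k) i)

≡-by-true : ∀ {a b} → (a ≡ true → b ≡ true) → (b ≡ true → a ≡ true) → a ≡ b
≡-by-true {false} {false} _ _ = refl
≡-by-true {false} {true}  _ g = g refl
≡-by-true {true}          f _ = sym (f refl)

-- Fits are carried forward along every permutation; the converse applies this to the inverse of σ
-- and the permuted input.
property-invariant : ∀ n k m s → IsHypergraphProperty n k (Property.property n k m s)
property-invariant n k m s x σ = ≡-by-true (forward σ x)
  (λ eq → subst (λ y → property y ≡ true) (permute-inverse n k σ x)
    (forward (Perm.flip σ) (permute {n} {k} σ x) eq))
  where
  open Property n k m s
  forward : ∀ σ x → property x ≡ true → property (permute {n} {k} σ x) ≡ true
  forward σ x eq with π , fits ← sound {x} eq = complete (relabel-fits σ π fits)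

-- Sensitivity at inputs where the property fails

length-filter-tabulate : ∀ {A : Set} {P : A → Set} (P? : Decidable P) {n} (f : Fin n → A) →
                         List.length (List.filter P? (List.tabulate f)) ≡ # (does ∘ P? ∘ f)
length-filter-tabulate P? {zero}  f = refl
length-filter-tabulate P? {suc n} f with does (P? (f zero))
... | true  = cong suc (length-filter-tabulate P? (f ∘ suc))
... | false = length-filter-tabulate P? (f ∘ suc)

sensitive-bits : ∀ {N} (f : BooleanFunction N) x →
  Σ[ e ∈ (Fin (sensitivityAt f x) → Fin N) ]
    Injective _≡_ _≡_ e × (∀ a → f x ≢ f (flipBit (e a) x))
sensitive-bits f x
  with e , e-inj , ok ← enumerate (λ i → does (¬? (f x Bool.≟ f (flipBit i x))))
         (≤-reflexive (length-filter-tabulate (λ i → ¬? (f x Bool.≟ f (flipBit i x))) id))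
  = e , e-inj , λ a → does-true (¬? (f x Bool.≟ f (flipBit (e a) x))) (ok a)

lookup-flipBit : ∀ {N} {i j : Fin N} (x : Vec Bool N) → j ≢ i → lookup (flipBit i x) j ≡ lookup x j
lookup-flipBit {i = i} {j} x j≢i = lookup∘updateAt′ j i j≢i x

inject₁-coarse : ∀ r → r ≢ pole → inject₁ (coarse r) ≡ r
inject₁-coarse 0F _ = refl
inject₁-coarse 1F _ = refl
inject₁-coarse 2F _ = refl
inject₁-coarse 3F _ = refl
inject₁-coarse 4F _ = refl
inject₁-coarse 5F r≢pole = contradiction refl r≢pole

same-coarse : ∀ r r′ → coarse r ≡ coarse r′ → r ≢ r′ →
              (r ≡ pole × r′ ≡ 4F) ⊎ (r ≡ 4F × r′ ≡ pole)
same-coarse r r′ eq r≢r′ with r ≟ pole | r′ ≟ pole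
... | yes refl | yes refl = contradiction refl r≢r′
... | yes refl | no r′≢   = inj₁ (refl , trans (sym (inject₁-coarse r′ r′≢)) (cong inject₁ (sym eq)))
... | no r≢    | yes refl = inj₂ (trans (sym (inject₁-coarse r r≢)) (cong inject₁ eq) , refl)
... | no r≢    | no r′≢   = contradiction
  (trans (sym (inject₁-coarse r r≢)) (trans (cong inject₁ eq) (inject₁-coarse r′ r′≢))) r≢r′

lookup-ext : ∀ {A : Set} {n} {u v : Vec A n} → (∀ i → lookup u i ≡ lookup v i) → u ≡ v
lookup-ext {u = u} {v} u≗v =
  trans (sym (tabulate∘lookup u)) (trans (tabulate-cong u≗v) (tabulate∘lookup v))

-- The double counting: each a owns the r distinct pairs (`K a`, `g a j`), and no pair has two
-- owners.
product-bound : ∀ {M r A B} (K : Fin M → Fin A) (g : Fin M → Fin r → Fin B) →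
                (∀ a → Injective _≡_ _≡_ (g a)) →
                (∀ a a′ j j′ → K a ≡ K a′ → g a j ≡ g a′ j′ → a ≡ a′) → M * r ≤ A * B
product-bound {M} {r} {A} {B} K g g-injective separated = injective⇒≤ {f = code ∘ remQuot r}
  (λ {c} {c′} eq → trans (sym (combine-remQuot {M} r c))
    (trans (cong (uncurry combine) (code-injective {remQuot r c} {remQuot r c′} eq))
      (combine-remQuot {M} r c′)))
  where
  code : Fin M × Fin r → Fin (A * B)
  code (a , j) = combine (K a) (g a j)

  code-injective : ∀ {p q} → code p ≡ code q → p ≡ q
  code-injective {a , j} {a′ , j′} eq
    with Ka≡ , g≡ ← combine-injective (K a) (g a j) (K a′) (g a′ j′) eq
    with refl ← separated a a′ j j′ Ka≡ g≡ = cong (a ,_) (g-injective a g≡)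

coreSet : ∀ {n} → Labelling n → Subset n
coreSet π = tabulate (λ v → class π v == 0F)

∣coreSet∣ : ∀ {n} (π : Labelling n) → ∣ coreSet π ∣ ≡ size π 0F
∣coreSet∣ π = trans (∣∣≡# (coreSet π)) (#-cong λ v → lookup∘tabulate (λ v → class π v == 0F) v)

module _ {n k l s : ℕ} (k≡ : k ≡ suc (3 * suc l)) (x : Vec Bool (n C k)) where

  private
    m = suc l

  -- S is neither of the flipped edges, so both flipped inputs agree with x there, and x would need
  -- both values.
  clash : ∀ {i j π π′} → Fits m s {k} (flipBit i x) π → Fits m s {k} (flipBit j x) π′ →
          ∀ S → ∣ S ∣ ≡ suc (3 * m) → S ≢ edge n k i → S ≢ edge n k j →
          Present m π S → ¬ Absent m π′ S
  clash {i} {j} {π} {π′} fits fits′ S ∣S∣ S≢i S≢j present absent = contradiction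
    (trans (sym x-true) x-false) λ ()
    where
    at : Fin (n C k)
    at = indexOf {n} {k} (S , trans ∣S∣ (sym k≡))

    edge-at : edge n k at ≡ S
    edge-at = edge-indexOf n k (S , trans ∣S∣ (sym k≡))

    x-true : lookup x at ≡ true
    x-true = trans (sym (lookup-flipBit x λ at≡i → S≢i (trans (sym edge-at) (cong (edge n k) at≡i))))
      (Fits.when-present fits at (subst (Present m π) (sym edge-at) present))

    x-false : lookup x at ≡ false
    x-false = trans (sym (lookup-flipBit x λ at≡j → S≢j (trans (sym edge-at) (cong (edge n k) at≡j))))
      (Fits.when-absent fits′ at (subst (Absent m π′) (sym edge-at) absent))

  -- The mark through v is present for π. Its only vertex of class 4F is v, which is no pole of π′,
  -- so the same edge is a mark without poles for π′ and must be absent.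
  mark-clash : ∀ {i j π π′} → Fits m s {k} (flipBit i x) π → Fits m s {k} (flipBit j x) π′ →
               (∀ v → class π v ≡ class π′ v) → ∀ v → lookup π v ≡ pole → lookup π′ v ≢ 4F
  mark-clash {i} {j} {π} {π′} fits fits′ aligned v πv π′v =
    clash fits fits′ T ∣T∣ T≢S T≢S′
      (on⁺ (#-positive {v = v} (cong₂ _∧_ v∈T (cong (_== pole) πv)))
        (profile-T 0F (λ ()) , inj₂ (inj₂ mark)))
      (off⁻ (#-none unpolar) (trans (same-profile 0F) (profile-T 0F λ ()))
        (trans (same-profile 3F) (proj₁ mark) ,
         trans (cong₂ _+_ (same-profile 1F) (same-profile 2F)) (proj₂ mark)))
    where
    edge-≤ : ∀ i → ∣ edge n k i ∣ ≤ suc (3 * m)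
    edge-≤ i = ≤-reflexive (trans (∣edge∣ n k i) k≡)

    open Marking (Fits.sized fits) {v} (class-pole π πv) (edge n k i) (edge n k j) (edge-≤ i) (edge-≤ j)

    same-profile : ∀ c → profile π′ T c ≡ profile π T c
    same-profile c = #-cong λ u → cong (λ d → lookup T u ∧ (d == c)) (sym (aligned u))

    unpolar : ∀ u → lookup T u ∧ (lookup π′ u == pole) ≡ false
    unpolar u with lookup T u in u∈T | lookup π′ u ≟ pole
    ... | false | _       = refl
    ... | true  | no _    = refl
    ... | true  | yes π′u = contradiction
      (trans (sym π′v) (trans (cong (lookup π′) (sym (free-only-v u u∈T
        (trans (aligned u) (class-pole π′ π′u))))) π′u)) λ ()

  module _ (x-fails : Property.property n k m s x ≡ false)
           (room : 2 * placed m + (1 + m) ≤ n) where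

    -- A pole b shared by two near misses with a common core lies outside the mismatched
    -- edges, so x obeys both patterns on all edges through b.
    collide : ∀ {i j π π′} → Fits m s {k} (flipBit i x) π → Fits m s {k} (flipBit j x) π′ →
              (∀ v → (class π v == 0F) ≡ (class π′ v == 0F)) →
              ∀ b → lookup π b ≡ pole → lookup π′ b ≡ pole →
              lookup (edge n k i) b ≡ false → lookup (edge n k j) b ≡ false → ¬ i ≢ j
    collide {i} {j} {π} {π′} fits fits′ same-core b πb π′b b∉i b∉j i≢j
      with Meeting.conflict⊎aligned (Fits.sized fits) (Fits.sized fits′) same-core πb π′b room
    ... | inj₁ (S , ∣S∣ , b∈S , inj₁ (present , absent)) = clash fits fits′ S ∣S∣
      (λ { refl → true≢false b∈S b∉i }) (λ { refl → true≢false b∈S b∉j }) present absent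
    ... | inj₁ (S , ∣S∣ , b∈S , inj₂ (absent , present)) = clash fits′ fits S ∣S∣
      (λ { refl → true≢false b∈S b∉j }) (λ { refl → true≢false b∈S b∉i }) present absent
    ... | inj₂ aligned with any? (λ v → ¬? (lookup π v ≟ lookup π′ v))
    ...   | yes (v , πv≢π′v) with same-coarse (lookup π v) (lookup π′ v) (aligned v) πv≢π′v
    ...     | inj₁ (πv , π′v) = mark-clash fits fits′ aligned v πv π′v
    ...     | inj₂ (πv , π′v) = mark-clash fits′ fits (sym ∘ aligned) v π′v πv
    -- The labellings coincide. Since i and j differ, every prescribed edge is left unflipped by one
    -- of the two flips, so x itself fits, although the property fails at x.
    collide {i} {j} {π} {π′} fits fits′ same-core b πb π′b b∉i b∉j i≢j
        | inj₂ aligned | no same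
      with refl ← lookup-ext {u = π} {π′} (λ v → decidable-stable (lookup π v ≟ lookup π′ v)
             (λ πv≢π′v → same (v , πv≢π′v)))
      = Property.refute n k m s x-fails {π} (fitting (Fits.sized fits) (Fits.pole-count fits)
          (λ a present → agree a (λ a≢i → Fits.when-present fits a present)
                                 (λ a≢j → Fits.when-present fits′ a present))
          (λ a absent → agree a (λ a≢i → Fits.when-absent fits a absent)
                                (λ a≢j → Fits.when-absent fits′ a absent)))
      where
      agree : ∀ a {y} → (a ≢ i → lookup (flipBit i x) a ≡ y) → (a ≢ j → lookup (flipBit j x) a ≡ y) →
              lookup x a ≡ y
      agree a on-i on-j with a ≟ i
      ... | no a≢i   = trans (sym (lookup-flipBit x a≢i)) (on-i a≢i)
      ... | yes refl = trans (sym (lookup-flipBit x i≢j)) (on-j i≢j)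

    -- The mismatched edge covers at most k of the r + k poles, which leaves r poles outside it. By
    -- `collide` the core together with any one of these determines the edge.
    near-misses-bound : ∀ {r M} → s ≡ r + k → (e : Fin M → Fin (n C k)) → Injective _≡_ _≡_ e →
                        (∀ a → ∃ (Fits m s {k} (flipBit (e a) x))) → M * r ≤ (n C m) * n
    near-misses-bound {r} {M} s≡ e e-injective near = product-bound
      (indexOf {n} {m} ∘ cores) (λ a → proj₁ (poles-of a)) (λ a → proj₁ (proj₂ (poles-of a)))
      (λ a a′ j j′ core≡ pole≡ → e-injective (same-bit a a′ j j′ core≡ pole≡))
      where
      label : Fin M → Labelling n
      label a = proj₁ (near a)

      cores : Fin M → KSubset n m
      cores a = coreSet (label a) , trans (∣coreSet∣ (label a)) (Sized.core-size (Fits.sized (proj₂ (near a))))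

      free-pole : Fin M → Fin n → Bool
      free-pole a v = (lookup (label a) v == pole) ∧ not (lookup (edge n k (e a)) v)

      r≤free-poles : ∀ a → r ≤ # (free-pole a)
      r≤free-poles a = +-cancelʳ-≤ k r _ (begin
        r + k                                            ≡⟨ s≡ ⟨
        s                                                ≡⟨ Fits.pole-count (proj₂ (near a)) ⟨
        poleCount (label a)
          ≤⟨ #-≤-outside (λ v → lookup (label a) v == pole) (lookup (edge n k (e a))) ⟩
        # (free-pole a) + # (lookup (edge n k (e a)))
          ≡⟨ cong (# (free-pole a) +_) (trans (sym (∣∣≡# (edge n k (e a)))) (∣edge∣ n k (e a))) ⟩
        # (free-pole a) + k                              ∎)
        where open ≤-Reasoning

      poles-of : ∀ a → Σ[ g ∈ (Fin r → Fin n) ] Injective _≡_ _≡_ g × (∀ j → free-pole a (g j) ≡ true)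
      poles-of a = enumerate (free-pole a) (r≤free-poles a)

      same-bit : ∀ a a′ j j′ → indexOf {n} {m} (cores a) ≡ indexOf {n} {m} (cores a′) →
                 proj₁ (poles-of a) j ≡ proj₁ (poles-of a′) j′ → e a ≡ e a′
      same-bit a a′ j j′ core≡ pole≡ = decidable-stable (e a ≟ e a′)
        (collide (proj₂ (near a)) (proj₂ (near a′)) same-core b
          (==-sound (proj₁ b-free)) (==-sound (proj₁ b-free′))
          (not-true (proj₂ b-free)) (not-true (proj₂ b-free′)))
        where
        same-coreSet : coreSet (label a) ≡ coreSet (label a′)
        same-coreSet = trans (sym (edge-indexOf n m (cores a)))
          (trans (cong (edge n m) (core≡)) (edge-indexOf n m (cores a′)))

        same-core : ∀ v → (class (label a) v == 0F) ≡ (class (label a′) v == 0F)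
        same-core v = trans (sym (lookup∘tabulate _ v))
          (trans (cong (λ S → lookup S v) same-coreSet) (lookup∘tabulate _ v))

        b = proj₁ (poles-of a) j

        b-free = ∧-true {lookup (label a) b == pole} (proj₂ (proj₂ (poles-of a)) j)

        b-free′ = ∧-true {lookup (label a′) b == pole}
          (subst (λ v → free-pole a′ v ≡ true) (sym (pole≡)) (proj₂ (proj₂ (poles-of a′)) j′))

        not-true : ∀ {y} → not y ≡ true → y ≡ false
        not-true {false} _ = refl

    fails-bound : ∀ {r} → s ≡ r + k → sensitivityAt (Property.property n k m s) x * r ≤ (n C m) * n
    fails-bound s≡ = near-misses-bound s≡ (proj₁ bits) (proj₁ (proj₂ bits)) λ a →
      sound {flipBit (proj₁ bits a) x} (flipped _ (proj₂ (proj₂ bits) a))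
      where
      open Property n k m s
      bits = sensitive-bits property x

      flipped : ∀ y → property x ≢ y → y ≡ true
      flipped true  _   = refl
      flipped false neq = contradiction x-fails neq

-- Sensitivity at inputs where the property holds

-- All sets with at most j elements outside X.
sparse : ∀ {n} → (Fin n → Bool) → ℕ → List (Subset n)
sparse {zero}  X j = Vec.[] ∷ []
sparse {suc n} X j with X zero | j
... | true  | j      = map (false Vec.∷_) (sparse (X ∘ suc) j) ++ map (true Vec.∷_) (sparse (X ∘ suc) j)
... | false | zero   = map (false Vec.∷_) (sparse (X ∘ suc) zero)
... | false | suc j′ = map (false Vec.∷_) (sparse (X ∘ suc) (suc j′)) ++
                       map (true Vec.∷_) (sparse (X ∘ suc) j′)

∈-sparse : ∀ {n} (X : Fin n → Bool) j (S : Subset n) →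
           # (λ v → lookup S v ∧ not (X v)) ≤ j → S ∈ sparse X j
∈-sparse X j Vec.[] _ = here refl
∈-sparse X j (a Vec.∷ S) few with X zero | j
∈-sparse X j (false Vec.∷ S) few | true  | j′     = ∈-++⁺ˡ (∈-map⁺ _ (∈-sparse (X ∘ suc) j′ S few))
∈-sparse X j (true Vec.∷ S)  few | true  | j′     =
  ∈-++⁺ʳ (map (false Vec.∷_) (sparse (X ∘ suc) j′)) (∈-map⁺ _ (∈-sparse (X ∘ suc) j′ S few))
∈-sparse X j (false Vec.∷ S) few | false | zero   = ∈-map⁺ _ (∈-sparse (X ∘ suc) zero S few)
∈-sparse X j (false Vec.∷ S) few | false | suc j′ = ∈-++⁺ˡ (∈-map⁺ _ (∈-sparse (X ∘ suc) (suc j′) S few))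
∈-sparse X j (true Vec.∷ S)  few | false | suc j′ =
  ∈-++⁺ʳ (map (false Vec.∷_) (sparse (X ∘ suc) (suc j′))) (∈-map⁺ _ (∈-sparse (X ∘ suc) j′ S (s≤s⁻¹ few)))

length-map-++-map : ∀ {A B : Set} (f g : A → B) xs ys →
                    length (map f xs ++ map g ys) ≡ length xs + length ys
length-map-++-map f g xs ys =
  trans (length-++ (map f xs)) (cong₂ _+_ (length-map f xs) (length-map g ys))

-- The trace on X is arbitrary, and each of j slots holds one of n vertices or stays empty, whence
-- the base `suc n`.
length-sparse : ∀ {n} (X : Fin n → Bool) j → length (sparse X j) ≤ 2 ^ # X * suc n ^ j
length-sparse {zero}  X j = ≤-reflexive (sym (trans (*-identityˡ (1 ^ j)) (^-zeroˡ j)))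
length-sparse {suc n} X j with X zero | j
... | true  | j′     = begin
  length (map (false Vec.∷_) xs ++ map (true Vec.∷_) xs) ≡⟨ length-map-++-map _ _ xs xs ⟩
  length xs + length xs                        ≤⟨ +-mono-≤ ih ih ⟩
  2 ^ c * suc n ^ j′ + 2 ^ c * suc n ^ j′      ≡⟨ double (2 ^ c) (suc n ^ j′) ⟩
  2 * 2 ^ c * suc n ^ j′                       ≤⟨ *-monoʳ-≤ (2 * 2 ^ c) (^-monoˡ-≤ j′ (n≤1+n (suc n))) ⟩
  2 * 2 ^ c * suc (suc n) ^ j′                 ∎
  where
  open ≤-Reasoning
  c  = # (X ∘ suc)
  xs = sparse (X ∘ suc) j′
  ih = length-sparse (X ∘ suc) j′
  double : ∀ a b → a * b + a * b ≡ 2 * a * b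
  double a b = solve (a ∷ b ∷ [])
... | false | zero   = begin
  length (map (false Vec.∷_) (sparse (X ∘ suc) 0)) ≡⟨ length-map _ (sparse (X ∘ suc) 0) ⟩
  length (sparse (X ∘ suc) 0)                      ≤⟨ length-sparse (X ∘ suc) 0 ⟩
  2 ^ # (X ∘ suc) * 1                              ∎
  where open ≤-Reasoning
... | false | suc j′ = begin
  length (map (false Vec.∷_) xs ++ map (true Vec.∷_) ys) ≡⟨ length-map-++-map _ _ xs ys ⟩
  length xs + length ys
    ≤⟨ +-mono-≤ (length-sparse (X ∘ suc) (suc j′)) (length-sparse (X ∘ suc) j′) ⟩
  2 ^ c * (suc n * suc n ^ j′) + 2 ^ c * suc n ^ j′  ≡⟨ collect (2 ^ c) n (suc n ^ j′) ⟩
  2 ^ c * (suc (suc n) * suc n ^ j′)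
    ≤⟨ *-monoʳ-≤ (2 ^ c) (*-monoʳ-≤ (suc (suc n)) (^-monoˡ-≤ j′ (n≤1+n (suc n)))) ⟩
  2 ^ c * (suc (suc n) * suc (suc n) ^ j′)           ∎
  where
  open ≤-Reasoning
  c  = # (X ∘ suc)
  xs = sparse (X ∘ suc) (suc j′)
  ys = sparse (X ∘ suc) j′
  collect : ∀ a b p → a * (suc b * p) + a * p ≡ a * (suc (suc b) * p)
  collect a b p = solve (a ∷ b ∷ p ∷ [])

length-cartesianProductWith : ∀ {A B C : Set} (f : A → B → C) xs ys →
                              length (cartesianProductWith f xs ys) ≡ length xs * length ys
length-cartesianProductWith f []       ys = refl
length-cartesianProductWith f (x ∷ xs) ys = trans (length-++ (map (f x) ys))
  (cong₂ _+_ (length-map (f x) ys) (length-cartesianProductWith f xs ys))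

module _ {n : ℕ} (m : ℕ) (π : Labelling n) where

  inPlace : Fin n → Bool
  inPlace v = not (class π v == 4F)

  poleList : List (Fin n)
  poleList = filter (λ v → lookup π v ≟ pole) (allFin n)

  -- A prescribed edge has at most m vertices outside the placed ones, after removal of one
  -- pole if it has any.
  relevant : List (Subset n)
  relevant = sparse inPlace m ++
             cartesianProductWith (λ b S → S [ b ]≔ true) poleList (sparse inPlace m)

  length-relevant : Sized m π →
    length relevant ≤ suc (poleCount π) * (2 ^ placed m * suc n ^ m)
  length-relevant sized = begin
    length relevant
      ≡⟨ length-++ (sparse inPlace m) ⟩
    length (sparse inPlace m) + length (cartesianProductWith _ poleList (sparse inPlace m))
      ≡⟨ cong (length (sparse inPlace m) +_) (length-cartesianProductWith (λ b S → S [ b ]≔ true) poleList (sparse inPlace m)) ⟩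
    suc (length poleList) * length (sparse inPlace m)
      ≡⟨ cong (λ p → suc p * length (sparse inPlace m)) (length-filter-tabulate (λ v → lookup π v ≟ pole) id) ⟩
    suc (poleCount π) * length (sparse inPlace m)
      ≤⟨ *-monoʳ-≤ (suc (poleCount π)) (length-sparse inPlace m) ⟩
    suc (poleCount π) * (2 ^ # inPlace * suc n ^ m)
      ≡⟨ cong (λ a → suc (poleCount π) * (2 ^ a * suc n ^ m)) (unfree sized) ⟩
    suc (poleCount π) * (2 ^ placed m * suc n ^ m) ∎
    where open ≤-Reasoning

  outside≡ : ∀ S → # (λ v → lookup S v ∧ not (inPlace v)) ≡ profile π S 4F
  outside≡ S = #-cong λ v → cong (lookup S v ∧_) (Bool.not-involutive (class π v == 4F))

  profile-sum : ∀ S → ∣ S ∣ ≡ profile π S 0F + (body (profile π S) + profile π S 4F)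
  profile-sum S = trans (trans (∣∣≡# S) (#-split (lookup S) (class π)))
    (regroup (profile π S 0F) (profile π S 1F) (profile π S 2F) (profile π S 3F) (profile π S 4F))
    where
    regroup : ∀ a b c d e → a + (b + (c + (d + (e + 0)))) ≡ a + ((b + (c + d)) + e)
    regroup a b c d e = solve (a ∷ b ∷ c ∷ d ∷ e ∷ [])

  -- Of 3 m + 1 vertices, m are core and at least m + j are body. It is used with j = 0 for edges
  -- with a pole and with j = m for marks without one.
  few-free : ∀ S {j} → ∣ S ∣ ≡ suc (3 * m) → profile π S 0F ≡ m → m + j ≤ body (profile π S) →
             profile π S 4F + j ≤ suc m
  few-free S {j} ∣S∣ core≡m big = +-cancelˡ-≤ (m + m) _ _ (begin
    m + m + (profile π S 4F + j)             ≡⟨ regroup m (profile π S 4F) j ⟩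
    m + ((m + j) + profile π S 4F)           ≤⟨ +-monoʳ-≤ m (+-monoˡ-≤ (profile π S 4F) big) ⟩
    m + (body (profile π S) + profile π S 4F)
      ≡⟨ cong (_+ (body (profile π S) + profile π S 4F)) core≡m ⟨
    profile π S 0F + (body (profile π S) + profile π S 4F) ≡⟨ profile-sum S ⟨
    ∣ S ∣                                    ≡⟨ ∣S∣ ⟩
    suc (3 * m)                              ≡⟨ split m ⟩
    m + m + suc m                            ∎)
    where
    open ≤-Reasoning
    regroup : ∀ a p j → a + a + (p + j) ≡ a + ((a + j) + p)
    regroup a p j = solve (a ∷ p ∷ j ∷ [])
    split : ∀ a → suc (3 * a) ≡ a + a + suc a
    split a = solve (a ∷ [])

  ∈-relevant-off : ∀ S → profile π S 4F ≤ m → S ∈ relevant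
  ∈-relevant-off S few = ∈-++⁺ˡ (∈-sparse inPlace m S (subst (_≤ m) (sym (outside≡ S)) few))

  ∈-relevant-on : ∀ S → 1 ≤ poles π S → profile π S 4F ≤ suc m → S ∈ relevant
  ∈-relevant-on S polar few
    with b , b-ok ← #-witness {p = λ v → lookup S v ∧ (lookup π v == pole)} polar
    with b∈S , πb ← ∧-true {lookup S b} b-ok
    = ∈-++⁺ʳ (sparse inPlace m) (subst (_∈ _) S⁻⁺≡S
        (∈-cartesianProductWith⁺ (λ b S → S [ b ]≔ true)
          (∈-filter⁺ (λ v → lookup π v ≟ pole) (∈-allFin b) (==-sound πb))
          (∈-sparse inPlace m S⁻ (s≤s⁻¹ (subst (_≤ suc m) count few)))))
    where
    S⁻ = S [ b ]≔ false

    S⁻⁺≡S : S⁻ [ b ]≔ true ≡ S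
    S⁻⁺≡S = trans ([]≔-idempotent S b)
      (trans (cong (S [ b ]≔_) (sym b∈S)) ([]≔-lookup S b))

    count : profile π S 4F ≡ suc (# (λ v → lookup S⁻ v ∧ not (inPlace v)))
    count = begin
      profile π S 4F                     ≡⟨ cong (λ T → profile π T 4F) S⁻⁺≡S ⟨
      profile π (S⁻ [ b ]≔ true) 4F
        ≡⟨ #-insert S⁻ (λ v → class π v == 4F) b (lookup∘updateAt b S) ⟩
      bit (class π b == 4F) + profile π S⁻ 4F
        ≡⟨ cong₂ _+_ (cong (λ c → bit (c == 4F)) (class-pole π (==-sound πb))) (sym (outside≡ S⁻)) ⟩
      suc (# (λ v → lookup S⁻ v ∧ not (inPlace v))) ∎
      where open ≡-Reasoning

Positive⇒big : ∀ {m} p → Positive m p → m ≤ body p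
Positive⇒big p (_ , inj₁ (b , _)) = ≤-reflexive (sym b)
Positive⇒big p (_ , inj₂ (inj₁ (b , _))) = ≤-trans (n≤1+n _) (≤-reflexive (sym b))
Positive⇒big {m} p (_ , inj₂ (inj₂ (a , _))) = begin
  m                      ≤⟨ m≤m+n m _ ⟩
  2 * m                  ≡⟨ a ⟨
  p 3F                   ≤⟨ m≤n+m (p 3F) (p 1F + p 2F) ⟩
  p 1F + p 2F + p 3F     ≡⟨ +-assoc (p 1F) (p 2F) (p 3F) ⟩
  p 1F + (p 2F + p 3F)   ∎
  where open ≤-Reasoning

Negative⇒big : ∀ {m} p → Negative m p → m ≤ body p
Negative⇒big p (_ , inj₁ (b , _)) = ≤-reflexive (sym b)
Negative⇒big p (_ , inj₂ (b , _)) = ≤-trans (n≤1+n _) (≤-reflexive (sym b))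

module _ {n l : ℕ} (π : Labelling n) (S : Subset n) (∣S∣ : ∣ S ∣ ≡ suc (3 * suc l)) where

  private
    on : 1 ≤ poles π S → profile π S 0F ≡ suc l → suc l ≤ body (profile π S) → S ∈ relevant (suc l) π
    on polar core≡m big = ∈-relevant-on (suc l) π S polar
      (subst (_≤ suc (suc l)) (+-identityʳ _)
        (few-free (suc l) π S {0} ∣S∣ core≡m (subst (_≤ body (profile π S)) (sym (+-identityʳ (suc l))) big)))

  Present⇒∈-relevant : Present (suc l) π S → S ∈ relevant (suc l) π
  Present⇒∈-relevant (on⁺ polar pos) = on polar (proj₁ pos) (Positive⇒big (profile π S) pos)

  Absent⇒∈-relevant : Absent (suc l) π S → S ∈ relevant (suc l) π
  Absent⇒∈-relevant (on⁻ polar neg) = on polar (proj₁ neg) (Negative⇒big (profile π S) neg)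
  Absent⇒∈-relevant (off⁻ _ core≡m (≡2m , ≡0)) = ∈-relevant-off (suc l) π S
    (≤-trans (+-cancelʳ-≤ (suc l) (profile π S 4F) 1
      (few-free (suc l) π S {suc l} ∣S∣ core≡m (≤-reflexive (sym (begin
        p 1F + (p 2F + p 3F)   ≡⟨ +-assoc (p 1F) (p 2F) (p 3F) ⟨
        p 1F + p 2F + p 3F     ≡⟨ cong₂ _+_ ≡0 ≡2m ⟩
        2 * suc l              ≡⟨ cong (suc l +_) (+-identityʳ (suc l)) ⟩
        suc l + suc l          ∎))))) (s≤s z≤n))
    where
    open ≡-Reasoning
    p = profile π S

indexed-bound : ∀ {A : Set} {M} (f : Fin M → A) (xs : List A) → Injective _≡_ _≡_ f →
                (∀ a → f a ∈ xs) → M ≤ length xs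
indexed-bound f xs f-injective f∈ = injective⇒≤ {f = λ a → index (f∈ a)}
  λ {a} {b} eq → f-injective (index-injective (setoid _) (f∈ a) (f∈ b) eq)

-- Flipping an edge on which the pattern is silent cannot spoil the fit.
specified : ∀ {n k m s} {x : Vec Bool (n C k)} {π} → Fits m s {k} x π → ∀ i →
            ¬ Fits m s {k} (flipBit i x) π →
            Present m π (edge n k i) ⊎ Absent m π (edge n k i)
specified {n} {k} {m} {x = x} {π} fits i broken
  with Present? m π (edge n k i) | Absent? m π (edge n k i)
... | yes present | _           = inj₁ present
... | no _        | yes absent  = inj₂ absent
... | no ¬present | no ¬absent  = contradiction
  (fitting (Fits.sized fits) (Fits.pole-count fits)
    (λ j present → trans
      (lookup-flipBit x (λ j≡i → ¬present (subst (Present m π ∘ edge n k) j≡i present)))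
      (Fits.when-present fits j present))
    (λ j absent → trans
      (lookup-flipBit x (λ j≡i → ¬absent (subst (Absent m π ∘ edge n k) j≡i absent)))
      (Fits.when-absent fits j absent)))
  broken

fitting-bound : ∀ {n k l s M} → k ≡ suc (3 * suc l) → {x : Vec Bool (n C k)} {π : Labelling n} →
                Fits (suc l) s {k} x π →
                (e : Fin M → Fin (n C k)) → Injective _≡_ _≡_ e →
                (∀ a → ¬ Fits (suc l) s {k} (flipBit (e a) x) π) →
                M ≤ suc s * (2 ^ placed (suc l) * suc n ^ suc l)
fitting-bound {n} {k} {l} {s} k≡ {x} {π} fits e e-injective broken = ≤-trans
  (indexed-bound (edge n k ∘ e) (relevant (suc l) π) (λ eq → e-injective (edge-injective n k eq)) edge∈)
  (subst (λ c → length (relevant (suc l) π) ≤ suc c * (2 ^ placed (suc l) * suc n ^ suc l))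
    (Fits.pole-count fits) (length-relevant (suc l) π (Fits.sized fits)))
  where
  edge∈ : ∀ a → edge n k (e a) ∈ relevant (suc l) π
  edge∈ a = [ Present⇒∈-relevant π (edge n k (e a)) (trans (∣edge∣ n k (e a)) k≡)
            , Absent⇒∈-relevant π (edge n k (e a)) (trans (∣edge∣ n k (e a)) k≡)
            ]′ (specified fits (e a) (broken a))

-- A single fitting pattern suffices: a sensitive flip leaves no fit at all, so it spoils this one
-- and hits one of its prescribed edges.
holds-bound : ∀ {n k l s} → k ≡ suc (3 * suc l) → (x : Vec Bool (n C k)) →
              Property.property n k (suc l) s x ≡ true →
              sensitivityAt (Property.property n k (suc l) s) x ≤
              suc s * (2 ^ placed (suc l) * suc n ^ suc l)
holds-bound {n} {k} {l} {s} k≡ x x-holds =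
  fitting-bound k≡ {x} {proj₁ found} (proj₂ found) (proj₁ bits) (proj₁ (proj₂ bits))
    λ a → refute {flipBit (proj₁ bits a) x} (unflipped _ (proj₂ (proj₂ bits) a)) {proj₁ found}
  where
  open Property n k (suc l) s
  bits = sensitive-bits property x
  found = sound {x} x-holds

  unflipped : ∀ y → property x ≢ y → y ≡ false
  unflipped false _   = refl
  unflipped true  neq = contradiction x-holds neq

-- Existence of patterns, and non-constancy

#-++-replicate : ∀ {n} (ψ : Role → Bool) a r (π : Labelling n) →
  # (λ v → ψ (lookup (replicate a r Vec.++ π) v)) ≡ (if ψ r then a else 0) + # (λ v → ψ (lookup π v))
#-++-replicate ψ zero    r π with ψ r
... | true  = refl
... | false = refl
#-++-replicate ψ (suc a) r π with ψ r | #-++-replicate ψ a r π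
... | true  | eq = cong suc eq
... | false | eq = eq

countRuns : (Role → Bool) → List (ℕ × Role) → ℕ
countRuns ψ []             = 0
countRuns ψ ((a , r) ∷ rs) = (if ψ r then a else 0) + countRuns ψ rs

fromRuns : ∀ rs → Labelling (countRuns (const true) rs)
fromRuns []             = Vec.[]
fromRuns ((a , r) ∷ rs) = replicate a r Vec.++ fromRuns rs

#-fromRuns : ∀ ψ rs → # (λ v → ψ (lookup (fromRuns rs) v)) ≡ countRuns ψ rs
#-fromRuns ψ []             = refl
#-fromRuns ψ ((a , r) ∷ rs) =
  trans (#-++-replicate ψ a r (fromRuns rs)) (cong ((if ψ r then a else 0) +_) (#-fromRuns ψ rs))

roleRuns : (m s rest : ℕ) → List (ℕ × Role)
roleRuns m s rest =
  (m , 0F) ∷ (1 , 1F) ∷ (m , 2F) ∷ (bases m , 3F) ∷ (s , pole) ∷ (rest , 4F) ∷ []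

roleRuns-sized : ∀ m s rest → Sized m (fromRuns (roleRuns m s rest))
roleRuns-sized m s rest = record
  { core-size = trans (#-fromRuns (λ r → coarse r == 0F) (roleRuns m s rest)) (+-identityʳ m)
  ; apex-size = #-fromRuns (λ r → coarse r == 1F) (roleRuns m s rest)
  ; wing-size = trans (#-fromRuns (λ r → coarse r == 2F) (roleRuns m s rest)) (+-identityʳ m)
  ; base-size = trans (#-fromRuns (λ r → coarse r == 3F) (roleRuns m s rest)) (+-identityʳ (bases m)) }

roleRuns-poles : ∀ m s rest → poleCount (fromRuns (roleRuns m s rest)) ≡ s
roleRuns-poles m s rest = trans (#-fromRuns (_== pole) (roleRuns m s rest)) (+-identityʳ s)

labelling-exists : ∀ {n m s} → placed m + s ≤ n → ∃ λ (π : Labelling n) → Sized m π × poleCount π ≡ s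
labelling-exists {n} {m} {s} le = subst (λ n → ∃ λ (π : Labelling n) → Sized m π × poleCount π ≡ s)
  (trans (regroup m (bases m) s rest) (m+[n∸m]≡n le))
  (fromRuns (roleRuns m s rest) , roleRuns-sized m s rest , roleRuns-poles m s rest)
  where
  rest = n ∸ (placed m + s)
  regroup : ∀ a b c d → a + (1 + (a + (b + (c + (d + 0))))) ≡ a + (1 + (a + b)) + c + d
  regroup a b c d = solve (a ∷ b ∷ c ∷ d ∷ [])

module _ {n k l s : ℕ} (k≡ : k ≡ suc (3 * suc l)) where

  private
    m = suc l

  -- Any pole forces its marks to be present. Nothing has to be avoided here, so `Marking` is
  -- applied to empty sets.
  empty-misfit : 1 ≤ s → ∀ {π} → ¬ Fits m s {k} (replicate (n C k) false) π
  empty-misfit 1≤s {π} fits = contradiction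
    (trans (sym (Fits.when-present fits at (subst (Present m π) (sym edge-at) T-present)))
      (lookup-replicate at false))
    λ ()
    where
    some-pole : ∃ λ v → (lookup π v == pole) ≡ true
    some-pole = #-witness (subst (1 ≤_) (sym (Fits.pole-count fits)) 1≤s)

    v = proj₁ some-pole

    πv : lookup π v ≡ pole
    πv = ==-sound (proj₂ some-pole)

    ∣⊥∣≤ : ∣ ⊥ {n} ∣ ≤ suc (3 * m)
    ∣⊥∣≤ = subst (_≤ suc (3 * m)) (sym (∣⊥∣≡0 n)) z≤n

    open Marking (Fits.sized fits) {v} (class-pole π πv) ⊥ ⊥ ∣⊥∣≤ ∣⊥∣≤

    at : Fin (n C k)
    at = indexOf {n} {k} (T , trans ∣T∣ (sym k≡))

    edge-at : edge n k at ≡ T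
    edge-at = edge-indexOf n k (T , trans ∣T∣ (sym k≡))

    T-present : Present m π T
    T-present = on⁺ (#-positive {v = v} (cong₂ _∧_ v∈T (cong (_== pole) πv)))
      (profile-T 0F (λ ()) , inj₂ (inj₂ mark))

  pattern-fits : ∀ {π} → Sized m π → poleCount π ≡ s →
                 Fits m s {k} (tabulate (λ i → does (Present? m π (edge n k i)))) π
  pattern-fits {π} sized pole-count = fitting sized pole-count
    (λ i present → trans (x-at i) (dec-true (Present? m π (edge n k i)) present))
    (λ i absent → trans (x-at i)
      (dec-false (Present? m π (edge n k i)) (λ present → ¬Present×Absent present absent)))
    where
    x-at = lookup∘tabulate (λ i → does (Present? m π (edge n k i)))

  property-nonConstant : 1 ≤ s → placed m + s ≤ n → NonConstant (Property.property n k m s)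
  property-nonConstant 1≤s enough =
    x , replicate (n C k) false , λ eq →
      empty-misfit 1≤s (proj₂ (sound {replicate (n C k) false} (trans (sym eq) (complete {x} {π} fits))))
    where
    open Property n k m s
    exists = labelling-exists {n} {m} {s} enough
    π = proj₁ exists
    x = tabulate (λ i → does (Present? m π (edge n k i)))
    fits = pattern-fits {π} (proj₁ (proj₂ exists)) (proj₂ (proj₂ exists))

-- Small n, and the final estimates

-- Stands in for the boundedly many n below the threshold; its sensitivity there is absorbed by the
-- constant.
allTrue : ∀ {N} → BooleanFunction N
allTrue x = does (all? λ i → lookup x i Bool.≟ true)

module _ {N : ℕ} {x : Vec Bool N} where

  allTrue-sound : allTrue x ≡ true → ∀ i → lookup x i ≡ true
  allTrue-sound = does-true (all? λ i → lookup x i Bool.≟ true)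

  allTrue-complete : (∀ i → lookup x i ≡ true) → allTrue x ≡ true
  allTrue-complete = dec-true (all? λ i → lookup x i Bool.≟ true)

allTrue-invariant : ∀ n k → IsHypergraphProperty n k allTrue
allTrue-invariant n k x σ = ≡-by-true (forward σ x)
  (λ eq → subst (λ y → allTrue y ≡ true) (permute-inverse n k σ x)
    (forward (Perm.flip σ) (permute {n} {k} σ x) eq))
  where
  forward : ∀ σ x → allTrue x ≡ true → allTrue (permute {n} {k} σ x) ≡ true
  forward σ x eq = allTrue-complete {x = permute {n} {k} σ x} λ i →
    trans (lookup∘tabulate (lookup x ∘ moved) i) (allTrue-sound {x = x} eq (moved i))
    where
    moved : Fin (n C k) → Fin (n C k)
    moved i = indexOf {n} {k} (imageₖ σ (subsetAt {n} {k} i))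

someEdge : ∀ {n k} → k ≤ n → KSubset n k
someEdge {n} {k} k≤n = S , trans (∣∣≡# S) (trans
  (#-cong λ v → sym (Bool.∧-identityʳ (lookup S v))) (proj₂ (proj₂ selection) 0F))
  where
  selection = select (_≟_ {1}) {n} (const true) (const 0F) (const k)
    λ { 0F → ≤-trans k≤n (≤-reflexive (sym (#-all n))) }
  S = proj₁ selection

allTrue-nonConstant : ∀ {n k} → k ≤ n → NonConstant (allTrue {n C k})
allTrue-nonConstant {n} {k} k≤n = ones , zeros , λ eq → contradiction
  (trans (sym (allTrue-sound {x = zeros} (trans (sym eq) ones-true) at)) (lookup-replicate at false))
  λ ()
  where
  ones  = replicate (n C k) true
  zeros = replicate (n C k) false

  ones-true : allTrue ones ≡ true
  ones-true = allTrue-complete {x = ones} λ i → lookup-replicate i true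

  at : Fin (n C k)
  at = indexOf {n} {k} (someEdge k≤n)

sensitivity-≤ : ∀ {N} (f : BooleanFunction N) {B} → (∀ x → sensitivityAt f x ≤ B) → sensitivity f ≤ B
sensitivity-≤ {N} f bound = max≤v⁺ z≤n (All.map⁺ (All.universal bound (allInputs N)))

sensitivity≤N : ∀ {N} (f : BooleanFunction N) → sensitivity f ≤ N
sensitivity≤N f = sensitivity-≤ f λ x → injective⇒≤ (proj₁ (proj₂ (sensitive-bits f x)))

nCk≤n^k : ∀ n k → n C k ≤ n ^ k
nCk≤n^k n       zero    = ≤-reflexive (nC0≡1 n)
  where
  nC0≡1 : ∀ n → n C 0 ≡ 1
  nC0≡1 zero    = refl
  nC0≡1 (suc n) = refl
nCk≤n^k zero    (suc k) = z≤n
nCk≤n^k (suc n) (suc k) = begin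
  suc n C suc k             ≡⟨ nCk+nC[k+1]≡[n+1]C[k+1] n k ⟨
  n C k + n C suc k         ≤⟨ +-mono-≤ (nCk≤n^k n k) (nCk≤n^k n (suc k)) ⟩
  suc n * n ^ k             ≤⟨ *-monoʳ-≤ (suc n) (^-monoˡ-≤ k (n≤1+n n)) ⟩
  suc n * suc n ^ k         ∎
  where open ≤-Reasoning

[m*n]^o≡m^o*n^o : ∀ m n o → (m * n) ^ o ≡ m ^ o * n ^ o
[m*n]^o≡m^o*n^o m n zero    = refl
[m*n]^o≡m^o*n^o m n (suc o) =
  trans (cong (m * n *_) ([m*n]^o≡m^o*n^o m n o)) ([m*n]*[o*p]≡[m*o]*[n*p] m n (m ^ o) (n ^ o))

squareRoot : ∀ n → ∃[ r ] r * r ≤ n × n < suc r * suc r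
squareRoot zero    = 0 , z≤n , s≤s z≤n
squareRoot (suc n) with r , r²≤n , n<[1+r]² ← squareRoot n with suc r * suc r ≤? suc n
... | yes [1+r]²≤ = suc r , [1+r]²≤ , ≤-trans (s≤s n<[1+r]²) (*-mono-< (n<1+n (suc r)) (n<1+n (suc r)))
... | no  ≰       = r , m≤n⇒m≤1+n r²≤n , ≰⇒> ≰

-- The factor 2 + k comes from 1 + r + k ≤ (2 + k) · r, the power 2 ^ `placed m` counts traces on
-- the placed vertices, and 2 ^ m pays for replacing n + 1 by 2 · n.
c₁ : ℕ → ℕ → ℕ
c₁ k m = (2 + k) * (2 ^ placed m * 2 ^ m)

module Large {n k l r : ℕ} (k≡ : k ≡ suc (3 * suc l)) (1≤n : 1 ≤ n) (1≤r : 1 ≤ r)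
  (n<[1+r]² : n < suc r * suc r)
  (room : 2 * placed (suc l) + (1 + suc l) ≤ n)
  where

  private
    m = suc l
    -- Here r is the integer square root of n; the k extra poles make up for those that a mismatched
    -- edge may contain.
    s = r + k

  open Property n k m s

  holds-≤ : ∀ x → property x ≡ true → sensitivityAt property x ≤ c₁ k m * (r * n ^ m)
  holds-≤ x x-holds = ≤-trans (holds-bound k≡ x x-holds)
    (arithmetic (2 ^ placed m) m)
    where
    arithmetic : ∀ P m → suc (r + k) * (P * suc n ^ m) ≤ (2 + k) * (P * 2 ^ m) * (r * n ^ m)
    arithmetic P m = begin
      suc (r + k) * (P * suc n ^ m)
        ≤⟨ *-mono-≤ (+-mono-≤ 1≤r (+-monoʳ-≤ r (m≤m*n k r {{>-nonZero 1≤r}})))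
             (*-monoʳ-≤ P (^-monoˡ-≤ m (≤-trans (+-monoˡ-≤ n 1≤n) (+-monoʳ-≤ n (m≤m+n n 0))))) ⟩
      (r + (r + k * r)) * (P * (2 * n) ^ m)
        ≡⟨ cong (λ x → (r + (r + k * r)) * (P * x)) ([m*n]^o≡m^o*n^o 2 n m) ⟩
      (r + (r + k * r)) * (P * (2 ^ m * n ^ m))
        ≡⟨ regroup (2 ^ m) (n ^ m) P r k ⟩
      (2 + k) * (P * 2 ^ m) * (r * n ^ m) ∎
      where
      open ≤-Reasoning
      regroup : ∀ a b p r k → (r + (r + k * r)) * (p * (a * b)) ≡ (2 + k) * (p * a) * (r * b)
      regroup a b p r k = solve (a ∷ b ∷ p ∷ r ∷ k ∷ [])

  n≤3r² : n ≤ 3 * (r * r)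
  n≤3r² = s≤s⁻¹ (≤-trans n<[1+r]² (begin
    suc r * suc r                  ≡⟨ expand r ⟩
    suc (r * r + 2 * r)            ≤⟨ s≤s (+-monoʳ-≤ (r * r) (*-monoʳ-≤ 2 (m≤m*n r r {{>-nonZero 1≤r}}))) ⟩
    suc (r * r + 2 * (r * r))      ∎))
    where
    open ≤-Reasoning
    expand : ∀ r → suc r * suc r ≡ suc (r * r + 2 * r)
    expand r = solve (r ∷ [])

  fails-≤ : ∀ x → property x ≡ false → sensitivityAt property x ≤ 3 * (r * n ^ m)
  fails-≤ x x-fails = *-cancelʳ-≤ _ _ r {{>-nonZero 1≤r}} (≤-trans
    (fails-bound k≡ x x-fails room {r} refl) (arithmetic m))
    where
    arithmetic : ∀ m → (n C m) * n ≤ 3 * (r * n ^ m) * r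
    arithmetic m = begin
      (n C m) * n               ≤⟨ *-mono-≤ (nCk≤n^k n m) n≤3r² ⟩
      n ^ m * (3 * (r * r))     ≡⟨ regroup (n ^ m) r ⟩
      3 * (r * n ^ m) * r       ∎
      where
      open ≤-Reasoning
      regroup : ∀ a r → a * (3 * (r * r)) ≡ 3 * (r * a) * r
      regroup a r = solve (a ∷ r ∷ [])

  property-≤ : sensitivity property ≤ (c₁ k m + 3) * (r * n ^ m)
  property-≤ = sensitivity-≤ property λ x → at x (property x) refl
    where
    at : ∀ x y → property x ≡ y → sensitivityAt property x ≤ (c₁ k m + 3) * (r * n ^ m)
    at x true  eq = ≤-trans (holds-≤ x eq) (*-monoˡ-≤ (r * n ^ m) (m≤m+n (c₁ k m) 3))
    at x false eq = ≤-trans (fails-≤ x eq) (*-monoˡ-≤ (r * n ^ m) (m≤n+m 3 (c₁ k m)))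

⌈1+3m/3⌉ : ∀ m → ⌈ suc (3 * m) /3⌉ ≡ suc m
⌈1+3m/3⌉ m = trans (cong (_/ 3) (regroup m)) (m*n/n≡m (suc m) 3)
  where
  regroup : ∀ m → suc (3 * m) + 2 ≡ suc m * 3
  regroup m = solve (m ∷ [])

exponent : ∀ {k m} → k ≡ suc (3 * m) → 2 * ⌈ k /3⌉ ∸ 1 ≡ suc (2 * m)
exponent {m = m} refl rewrite ⌈1+3m/3⌉ m = +-suc m (m + 0)

≡1-mod-3 : ∀ {k} → 4 ≤ k → k % 3 ≡ 1 → ∃[ l ] k ≡ suc (3 * suc l)
≡1-mod-3 {k} 4≤k k%3≡1 = positive (k / 3)
  (trans (m≡m%n+[m/n]*n k 3) (cong₂ _+_ k%3≡1 (*-comm (k / 3) 3)))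
  where
  positive : ∀ m → k ≡ suc (3 * m) → ∃[ l ] k ≡ suc (3 * suc l)
  positive zero    k≡1 = contradiction (subst (4 ≤_) k≡1 4≤k) λ { (s≤s ()) }
  positive (suc l) k≡  = l , k≡

module Bound {k l : ℕ} (k≡ : k ≡ suc (3 * suc l)) where

  private
    m = suc l

  -- If n is at least `threshold` + r, there is room for a pattern with r + k poles, and two
  -- patterns have enough common vertices of class 4F.
  threshold : ℕ
  threshold = 2 * placed m + (1 + m) + k

  c₂ : ℕ
  c₂ = (threshold + threshold) ^ k

  c : ℕ
  c = c₁ k m + 3 + c₂

  -- Squaring clears the half in the exponent: twice ⌈k/3⌉ - 1/2 is 2 m + 1.
  Good : (n : ℕ) → Set
  Good n = Σ[ f ∈ BooleanFunction (n C k) ]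
    IsHypergraphProperty n k f × NonConstant f ×
    sensitivity f ^ 2 ≤ c ^ 2 * n ^ (2 * ⌈ k /3⌉ ∸ 1)

  private
    goal-≤ : ∀ {n x} → x ≤ c ^ 2 * n ^ suc (2 * m) → x ≤ c ^ 2 * n ^ (2 * ⌈ k /3⌉ ∸ 1)
    goal-≤ {n} {x} = subst (λ e → x ≤ c ^ 2 * n ^ e) (sym (exponent {k} {m} k≡))

    square-bound : ∀ {a b r n} e M → a ≤ b * (r * n ^ M) → b ≤ e → r * r ≤ n →
                   a ^ 2 ≤ e ^ 2 * n ^ suc (2 * M)
    square-bound {a} {b} {r} {n} e M a≤ b≤e r²≤n = begin
      a ^ 2                               ≤⟨ ^-monoˡ-≤ 2 a≤ ⟩
      (b * (r * n ^ M)) ^ 2               ≡⟨ regroup b r (n ^ M) ⟩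
      b ^ 2 * (r * r * (n ^ M) ^ 2)
        ≤⟨ *-mono-≤ (^-monoˡ-≤ 2 b≤e) (*-monoˡ-≤ ((n ^ M) ^ 2) r²≤n) ⟩
      e ^ 2 * (n * (n ^ M) ^ 2)
        ≡⟨ cong (λ p → e ^ 2 * (n * p)) (trans (^-*-assoc n M 2) (cong (n ^_) (*-comm M 2))) ⟩
      e ^ 2 * n ^ suc (2 * M)             ∎
      where
      open ≤-Reasoning
      regroup : ∀ b r p → (b * (r * p)) * ((b * (r * p)) * 1) ≡ b * (b * 1) * (r * r * (p * (p * 1)))
      regroup b r p = solve (b ∷ r ∷ p ∷ [])

    -- If r exceeded K, then n ≥ r · r ≥ (K + 1) · r ≥ K + r. So the n not treated by patterns are
    -- at most twice the threshold, which is where `c₂` comes from.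
    few-roots : ∀ {r n} K → 1 ≤ r → r * r ≤ n → n < K + r → n ≤ K + K
    few-roots {r} {n} K 1≤r r²≤n n< with r ≤? K
    ... | yes r≤K = ≤-trans (<⇒≤ n<) (+-monoʳ-≤ K r≤K)
    ... | no  r≰K = contradiction n< (≤⇒≯ (begin
      K + r            ≤⟨ +-monoˡ-≤ r (m≤m*n K r {{>-nonZero 1≤r}}) ⟩
      K * r + r        ≡⟨ +-comm (K * r) r ⟩
      suc K * r        ≤⟨ *-monoˡ-≤ r (≰⇒> r≰K) ⟩
      r * r            ≤⟨ r²≤n ⟩
      n                ∎))
      where open ≤-Reasoning

    positive-root : ∀ {n r} → 1 ≤ n → n < suc r * suc r → 1 ≤ r
    positive-root {r = zero}  1≤n n<1 = contradiction 1≤n (<⇒≱ n<1)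
    positive-root {r = suc _} _   _   = s≤s z≤n

  good : ∀ n → k ≤ n → Good n
  good n k≤n with squareRoot n
  ... | r , r²≤n , n<[1+r]² with threshold + r ≤? n
  ...   | yes large = property , property-invariant n k m (r + k) ,
          property-nonConstant k≡ (≤-trans 1≤r (m≤m+n r k)) enough ,
          goal-≤ {n} (square-bound {b = c₁ k m + 3} {r} c m (property-≤) (m≤m+n (c₁ k m + 3) c₂) r²≤n)
    where
    1≤n = ≤-trans (≤-trans (s≤s z≤n) (≤-reflexive (sym k≡))) k≤n
    1≤r = positive-root {n} {r} 1≤n n<[1+r]²

    thresholds : ∀ p M K R → 2 * p + (1 + M) + K + R ≡ p + (R + K) + (p + (1 + M))
    thresholds p M K R = solve (p ∷ M ∷ K ∷ R ∷ [])

    enough : placed m + (r + k) ≤ n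
    enough = ≤-trans (≤-trans (m≤m+n _ _) (≤-reflexive (sym (thresholds (placed m) m k r)))) large

    room : 2 * placed m + (1 + m) ≤ n
    room = ≤-trans (≤-trans (m≤m+n _ k) (m≤m+n _ r)) large

    open Large {n} {k} {l} {r} k≡ 1≤n 1≤r n<[1+r]² room using (property-≤)
    open Property n k m (r + k) using (property)
  ...   | no  small = allTrue , allTrue-invariant n k , allTrue-nonConstant k≤n ,
          goal-≤ {n} (≤-trans (^-monoˡ-≤ 2 sensitivity≤c)
            (m≤m*n (c ^ 2) (n ^ suc (2 * m)) {{>-nonZero (m^n>0 n {{>-nonZero 1≤n}} (suc (2 * m)))}}))
    where
    1≤n = ≤-trans (≤-trans (s≤s z≤n) (≤-reflexive (sym k≡))) k≤n
    1≤r = positive-root {n} {r} 1≤n n<[1+r]²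

    sensitivity≤c : sensitivity (allTrue {n C k}) ≤ c
    sensitivity≤c = begin
      sensitivity (allTrue {n C k})       ≤⟨ sensitivity≤N allTrue ⟩
      n C k                               ≤⟨ nCk≤n^k n k ⟩
      n ^ k                               ≤⟨ ^-monoˡ-≤ k (few-roots threshold 1≤r r²≤n (≰⇒> small)) ⟩
      c₂                                  ≤⟨ m≤n+m c₂ (c₁ k m + 3) ⟩
      c                                   ∎
      where open ≤-Reasoning

theorem2 : (k : ℕ) → 4 ≤ k → k % 3 ≡ 1 →
    ∃[ c ] 0 < c ×
    (Σ[ f ∈ ((n : ℕ) → k ≤ n → BooleanFunction (n C k)) ]
    ((n : ℕ) (k≤n : k ≤ n) →
    IsHypergraphProperty n k (f n k≤n) ×
    NonConstant (f n k≤n) ×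
    sensitivity (f n k≤n) ^ 2 ≤ c ^ 2 * n ^ (2 * ⌈ k /3⌉ ∸ 1)))
theorem2 k 4≤k k%3≡1 =
  c , ≤-trans (≤-trans (s≤s z≤n) (m≤n+m 3 (c₁ k (suc l)))) (m≤m+n (c₁ k (suc l) + 3) c₂) ,
  (λ n k≤n → proj₁ (good n k≤n)) , λ n k≤n → proj₂ (good n k≤n)
  where
  l  = proj₁ (≡1-mod-3 4≤k k%3≡1)
  k≡ = proj₂ (≡1-mod-3 4≤k k%3≡1)
  open Bound {k} {l} k≡
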